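{- Every graph $G$ with $n\geq 3$ vertices and no $K_{3,3}$-minor has at most $\frac{4}{3}(7n-11)$ cliques. Conversely, for every integer $n\geq 5$ with $n\equiv 2\pmod 3$ there is a graph with $n$ vertices and no $K_{3,3}$-minor having exactly $\frac{4}{3}(7n-11)$ cliques.
   Context: All graphs are finite, simple and undirected. A graph $H$ is a minor of $G$ if $H$ can be obtained from a subgraph of $G$ by contracting edges. A clique is a (possibly empty) set of pairwise adjacent vertices; the number of cliques counts $\emptyset$ and single vertices. -}

module Defs where

import Data.Fin

open import Data.Nat using (ℕ; zero; suc; _<ᵇ_)
open import Data.Fin using (Fin; toℕ; _≟_)
open import Relation.Nullary.Decidable using (isYes)
open import Data.Bool using (Bool; true; false; _∧_; _xor_; not; if_then_else_)
open import Data.Vec using (Vec; []; _∷_; lookup)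
open import Data.List using (List; []; _∷_; map; _++_; length; filter)
open import Data.List.Relation.Unary.All using (All)
open import Data.Maybe using (Maybe; just; nothing)
open import Data.Product using (Σ; _×_; ∃; _,_)
open import Relation.Binary.PropositionalEquality using (_≡_)
open import Relation.Nullary using (¬_)
open import Data.Bool.Properties using (T?)
open import Data.Bool using (T)

record Graph (n : ℕ) : Set where
  field
    adj   : Fin n → Fin n → Bool
    sym   : ∀ u v → adj u v ≡ adj v u
    irrefl : ∀ v → adj v v ≡ false
open Graph public

data Connected {n : ℕ} (G : Graph n) (P : Fin n → Set) : Fin n → Fin n → Set where
  here : ∀ {u} → Connected G P u u
  step : ∀ {u v w} → adj G u v ≡ true → P v → Connected G P v w → Connected G P u w

record MinorModel {m n : ℕ} (H : Graph m) (G : Graph n) : Set where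
  field
    branch    : Fin n → Maybe (Fin m)
    nonempty  : ∀ i → ∃ λ v → branch v ≡ just i
    connected : ∀ i u v → branch u ≡ just i → branch v ≡ just i →
                Connected G (λ w → branch w ≡ just i) u v
    edges     : ∀ i j → adj H i j ≡ true →
                ∃ λ u → ∃ λ v → branch u ≡ just i × branch v ≡ just j × adj G u v ≡ true

IsMinor : {m n : ℕ} → Graph m → Graph n → Set
IsMinor H G = MinorModel H G

K33 : Graph 6
K33 = record { adj = a ; sym = s ; irrefl = r }
  where
  side : Fin 6 → Bool
  side i = toℕ i <ᵇ 3
  a : Fin 6 → Fin 6 → Bool
  a i j = side i xor side j
  s : ∀ u v → a u v ≡ a v u
  s u v = xor-comm (side u) (side v)
    where
    xor-comm : ∀ x y → (x xor y) ≡ (y xor x)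
    xor-comm true true = _≡_.refl
    xor-comm true false = _≡_.refl
    xor-comm false true = _≡_.refl
    xor-comm false false = _≡_.refl
  r : ∀ v → a v v ≡ false
  r v with side v
  ... | true = _≡_.refl
  ... | false = _≡_.refl

allSubsets : (n : ℕ) → List (Vec Bool n)
allSubsets zero = [] ∷ []
allSubsets (suc n) = map (true ∷_) (allSubsets n) ++ map (false ∷_) (allSubsets n)

allFinB : (n : ℕ) → (Fin n → Bool) → Bool
allFinB zero f = true
allFinB (suc n) f = f Data.Fin.zero ∧ allFinB n (λ i → f (Data.Fin.suc i))

isClique : {n : ℕ} → Graph n → Vec Bool n → Bool
isClique {n} G S = allFinB n λ u → allFinB n λ v →
  if lookup S u ∧ lookup S v ∧ not (isYes (u ≟ v)) then adj G u v else true

-- Number of cliques of G (including the empty set and single vertices).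
numCliques : {n : ℕ} → Graph n → ℕ
numCliques {n} G = length (filter (λ S → T? (isClique G S)) (allSubsets n))

{-# OPTIONS --safe #-}

-- Upper bound, by induction on the number n of vertices, as 3c + 44 ≤ 28n for c cliques.  For n ≤ 5
-- use c ≤ 2ⁿ.  Deleting a vertex of degree at most 3, or contracting an edge with at most two common
-- neighbours, loses at most 8 cliques.  Otherwise every edge lies in three triangles, so for any
-- vertex v the neighbourhood N(v) has minimum degree at least 3.  Such a graph contains a K₄ or a
-- K₂,₃ minor, hence with v a K₅ or a K₃,₃ minor.  A component of the complement of a K₅ with three
-- neighbours in it yields a K₃,₃ minor; so it has at most two, and the graph splits along an edge of
-- the K₅, where the two bounds add up exactly.
--
-- Lower bound: k triangles joined to both ends of an edge have 4 + 28k cliques.  In a K₃,₃ minor the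
-- branch sets avoiding that edge would be at least four disjoint sets inside a single triangle.

module Submission where

open import Defs hiding (sym)
open Graph using () renaming (sym to adj-sym)
open import Data.Bool using (Bool; true; false; _∧_; _∨_; not; if_then_else_; T)
import Data.Bool.Properties as Bool
open import Data.Bool.Properties using (T?; T-≡; T-∧; ∨-comm)
open import Data.Fin using (Fin; zero; suc; _≟_; _↑ˡ_; _↑ʳ_)
open import Data.Fin.Properties using (any?; all?; pigeonhole; <⇒≢; ↑ˡ-injective)
open import Data.Maybe using (Maybe; just; nothing; fromMaybe)
open import Data.Maybe.Properties using (just-injective)
open import Data.Fin.Subset
open import Data.Fin.Subset.Properties
open import Data.List using ([]; _∷_; map; _++_; length; filter)
open import Data.List.Properties using (filter-++; length-++)
open import Data.Nat using (ℕ; _∸_; _%_; _/_; _<?_; _≡ᵇ_; zero; suc; _+_; _*_; _^_; _≤_; _<_; _≤?_; z≤n; s≤s; s≤s⁻¹)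
open import Data.Nat.Properties hiding (_≟_; <⇒≢)
open import Data.Nat.DivMod using (m≡m%n+[m/n]*n)
open import Data.Nat.Tactic.RingSolver using (solve-∀)
open import Data.Product using (Σ; ∃; _×_; _,_; proj₁; proj₂)
open import Data.Sum as Sum using (_⊎_; inj₁; inj₂)
open import Data.Vec using (Vec; []; _∷_; lookup; tabulate)
open import Data.Vec.Base using (here; there)
open import Data.Vec.Relation.Unary.All using ([]; _∷_)
open import Data.Vec.Relation.Unary.All.Properties using (lookup⁺)
open import Data.Vec.Relation.Unary.AllPairs using (AllPairs; []; _∷_)
open import Data.Vec.Properties using (tabulate-cong; lookup∘tabulate; []=⇒lookup; lookup⇒[]=)
open import Function using (_∘_; id; case_of_; _⇔_; mk⇔; Equivalence)
open import Relation.Binary.PropositionalEquality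
open import Relation.Nullary using (¬_; Dec; yes; no; contradiction)
open import Relation.Nullary.Decidable using (isYes; from-yes; _×-dec_; _⊎-dec_; _→-dec_; ¬?)

-- The line `3c + 44 = 28n` passes through two graphs: K₅, and a single edge with its four cliques
-- (`3 · 4 + 44 = 28 · 2`). Gluing along an edge therefore preserves equality, and the extremal
-- graphs are copies of K₅ that share one edge. A single vertex is worth 28/3 cliques, so steps that
-- lose 8 have slack.
--
-- A graph of minimum degree 3 is not outerplanar, which is where K₄ and K₂,₃ come from. Two things
-- stand in the way of using this. Splitting needs a K₅ that is a subgraph, and a K₅ minor does not
-- suffice. Contracting an edge of N(v) also destroys the degree condition at the common neighbours
-- of its ends. So the degree condition is relaxed at the two ends of one edge, a form that survives
-- contraction, and a K₄ found after a contraction is pulled back: either it comes from a K₄, or `v`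
-- completes a K₃,₃ from the way it fails to.
--
-- The vertex type stays `Fin n` throughout. Clique counts and minors are taken relative to a vertex
-- set `p`, so deletion and contraction shrink `p`, and the induction runs on `∣ p ∣`.

private variable
  n : ℕ
  x y : Fin n

-- Subsets of `Fin n`: deletion, insertion and choice of elements

x∈p─q⁻ : ∀ (p q : Subset n) → x ∈ p ─ q → x ∈ p × x ∉ q
x∈p─q⁻ p q x∈ = p─q⊆p p q x∈ , ∉q p q x∈
  where
  ∉q : ∀ {n} {x : Fin n} (p q : Subset n) → x ∈ p ─ q → x ∉ q
  ∉q (s ∷ p) (outside ∷ q) (there x∈) (there x∈q) = ∉q p q x∈ x∈q
  ∉q (s ∷ p) (inside ∷ q) (there x∈) (there x∈q) = ∉q p q x∈ x∈q

x∈p-y⁻ : ∀ (p : Subset n) y → x ∈ p - y → x ∈ p × x ≢ y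
x∈p-y⁻ p y x∈ with x∈p─q⁻ p ⁅ y ⁆ x∈
... | x∈p , x∉y = x∈p , x∉⁅y⁆⇒x≢y x∉y

infixl 5 _⊕_
_⊕_ : Subset n → Fin n → Subset n
p ⊕ x = p ∪ ⁅ x ⁆

x∈p⊕x : ∀ (p : Subset n) x → x ∈ p ⊕ x
x∈p⊕x p x = x∈p∪q⁺ (inj₂ (x∈⁅x⁆ x))

p⊆p⊕x : ∀ (p : Subset n) x → p ⊆ p ⊕ x
p⊆p⊕x p x y∈p = x∈p∪q⁺ (inj₁ y∈p)

⊕-elim : ∀ {ℓ} (Q : Fin n → Set ℓ) (p : Subset n) {x} → (∀ {y} → y ∈ p → Q y) → Q x →
         ∀ {y} → y ∈ p ⊕ x → Q y
⊕-elim Q p {x} on-p on-x y∈ with x∈p∪q⁻ p ⁅ x ⁆ y∈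
... | inj₁ y∈p = on-p y∈p
... | inj₂ y∈x with refl ← x∈⁅y⁆⇒x≡y x y∈x = on-x

∣p∣≡1+∣p-x∣ : ∀ {p : Subset n} → x ∈ p → ∣ p ∣ ≡ suc ∣ p - x ∣
∣p∣≡1+∣p-x∣ {p = inside ∷ p} here = cong (λ q → suc ∣ q ∣) (sym (p─⊥≡p p))
∣p∣≡1+∣p-x∣ {p = inside ∷ p} (there x∈p) = cong suc (∣p∣≡1+∣p-x∣ x∈p)
∣p∣≡1+∣p-x∣ {p = outside ∷ p} (there x∈p) = ∣p∣≡1+∣p-x∣ x∈p

∣p⊕x∣≡1+∣p∣ : ∀ {p : Subset n} → x ∉ p → ∣ p ⊕ x ∣ ≡ suc ∣ p ∣
∣p⊕x∣≡1+∣p∣ {x = x} {p} x∉p = trans (∣p∣≡1+∣p-x∣ (x∈p⊕x p x)) (cong (suc ∘ ∣_∣) (⊆-antisym ⊆₁ ⊆₂))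
  where
  ⊆₁ : p ⊕ x - x ⊆ p
  ⊆₁ y∈ with x∈p-y⁻ (p ⊕ x) x y∈
  ... | y∈p⊕x , y≢x = ⊕-elim (λ y → y ≢ x → y ∈ p) p (λ y∈p _ → y∈p) (λ x≢x → contradiction refl x≢x) y∈p⊕x y≢x
  ⊆₂ : p ⊆ p ⊕ x - x
  ⊆₂ y∈p = x∈p∧x≢y⇒x∈p-y (p⊆p⊕x p x y∈p) (λ { refl → x∉p y∈p })

∣p∣≤1+∣p-x∣ : ∀ (p : Subset n) x → ∣ p ∣ ≤ suc ∣ p - x ∣
∣p∣≤1+∣p-x∣ p x with x ∈? p
... | yes x∈p = ≤-reflexive (∣p∣≡1+∣p-x∣ x∈p)
... | no x∉p = m≤n⇒m≤1+n (p⊆q⇒∣p∣≤∣q∣ {p = p} {q = p - x} λ y∈p → x∈p∧x≢y⇒x∈p-y y∈p λ { refl → x∉p y∈p })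

pick : ∀ {p : Subset n} {k} → suc k ≤ ∣ p ∣ → ∃ λ x → x ∈ p × k ≤ ∣ p - x ∣
pick {n} {p} k<p with nonempty? p
... | yes (x , x∈p) = x , x∈p , s≤s⁻¹ (≤-trans k<p (≤-reflexive (∣p∣≡1+∣p-x∣ x∈p)))
... | no empty with () ← ≤-trans k<p (≤-reflexive (trans (cong ∣_∣ (Empty-unique empty)) (∣⊥∣≡0 n)))

∣p∣≡0⇒x∉p : ∀ {p : Subset n} → ∣ p ∣ ≤ 0 → x ∉ p
∣p∣≡0⇒x∉p ∣p∣≤0 x∈p with () ← ≤-trans (≤-reflexive (sym (∣p∣≡1+∣p-x∣ x∈p))) ∣p∣≤0

∩-⊆ : ∀ (p q : Subset n) {p′ q′} → p ⊆ p′ → q ⊆ q′ → p ∩ q ⊆ p′ ∩ q′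
∩-⊆ p q p⊆ q⊆ x∈ with x∈p∩q⁻ p q x∈
... | x∈p , x∈q = x∈p∩q⁺ (p⊆ x∈p , q⊆ x∈q)

-- Clique counts

Adj : Graph n → Fin n → Fin n → Set
Adj G x y = adj G x y ≡ true

Adj-sym : ∀ (G : Graph n) → Adj G x y → Adj G y x
Adj-sym G xy = trans (adj-sym G _ _) xy

Adj⇒≢ : ∀ (G : Graph n) → Adj G x y → x ≢ y
Adj⇒≢ G xx refl with () ← trans (sym xx) (irrefl G _)

N : Graph n → Fin n → Subset n
N G v = tabulate (adj G v)

∈-tabulate⁺ : ∀ {f : Fin n → Bool} → f x ≡ true → x ∈ tabulate f
∈-tabulate⁺ {x = x} {f} fx = lookup⇒[]= x _ (trans (lookup∘tabulate f x) fx)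

∈-tabulate⁻ : ∀ {f : Fin n → Bool} → x ∈ tabulate f → f x ≡ true
∈-tabulate⁻ {x = x} {f} x∈ = trans (sym (lookup∘tabulate f x)) ([]=⇒lookup x∈)

∈-p∩N⁺ : ∀ (G : Graph n) {p} → x ∈ p → Adj G y x → x ∈ p ∩ N G y
∈-p∩N⁺ G x∈p yx = x∈p∩q⁺ (x∈p , ∈-tabulate⁺ yx)

∈-p∩N⁻ : ∀ (G : Graph n) p → x ∈ p ∩ N G y → x ∈ p × Adj G y x
∈-p∩N⁻ {y = y} G p x∈ with x∈p∩q⁻ p (N G y) x∈
... | x∈p , x∈N = x∈p , ∈-tabulate⁻ x∈N

tail : Graph (suc n) → Graph n
tail G = record
  { adj = λ u v → adj G (suc u) (suc v)
  ; sym = λ u v → adj-sym G (suc u) (suc v)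
  ; irrefl = λ v → irrefl G (suc v) }

N₀ : Graph (suc n) → Subset n
N₀ G = tabulate (λ i → adj G zero (suc i))

-- Splits on the first vertex: a clique containing it is that vertex together with a clique of its
-- neighbourhood.
cliques : Graph n → Subset n → ℕ
cliques G [] = 1
cliques G (outside ∷ p) = cliques (tail G) p
cliques G (inside ∷ p) = cliques (tail G) p + cliques (tail G) (p ∩ N₀ G)

-- Two graphs appear because a graph gets compared with its contraction.
cliques-mono : ∀ (G H : Graph n) {p q : Subset n} → p ⊆ q →
               (∀ {x y} → x ∈ p → y ∈ p → Adj G x y → Adj H x y) → cliques G p ≤ cliques H q
cliques-mono G H {[]} {[]} p⊆q G⊆H = ≤-refl
cliques-mono G H {outside ∷ p} {outside ∷ q} p⊆q G⊆H =
  cliques-mono (tail G) (tail H) (drop-∷-⊆ p⊆q) (λ x y → G⊆H (there x) (there y))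
cliques-mono G H {outside ∷ p} {inside ∷ q} p⊆q G⊆H =
  ≤-trans (cliques-mono (tail G) (tail H) (drop-∷-⊆ p⊆q) (λ x y → G⊆H (there x) (there y))) (m≤m+n _ _)
cliques-mono G H {inside ∷ p} {outside ∷ q} p⊆q G⊆H with () ← p⊆q here
cliques-mono G H {inside ∷ p} {inside ∷ q} p⊆q G⊆H = +-mono-≤
  (cliques-mono (tail G) (tail H) (drop-∷-⊆ p⊆q) (λ x y → G⊆H (there x) (there y)))
  (cliques-mono (tail G) (tail H) ∩⊆∩
    (λ x y → G⊆H (there (p∩q⊆p p (N₀ G) x)) (there (p∩q⊆p p (N₀ G) y))))
  where
  ∩⊆∩ : p ∩ N₀ G ⊆ q ∩ N₀ H
  ∩⊆∩ x∈ with x∈p∩q⁻ p (N₀ G) x∈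
  ... | x∈p , x∈N = x∈p∩q⁺ (drop-∷-⊆ p⊆q x∈p , ∈-tabulate⁺ (G⊆H here (there x∈p) (∈-tabulate⁻ x∈N)))

cliques-⊆ : ∀ (G : Graph n) {p q : Subset n} → p ⊆ q → cliques G p ≤ cliques G q
cliques-⊆ G p⊆q = cliques-mono G G p⊆q (λ _ _ → id)

-- Frees the recursion of `cliques` from the order of `Fin n`. If `x` and the first vertex are
-- adjacent, peeling them in either order gives the same four terms; otherwise no clique contains
-- both and three terms remain.
cliques-peel : ∀ (G : Graph n) {p : Subset n} → x ∈ p →
               cliques G p ≡ cliques G (p - x) + cliques G (p ∩ N G x)
cliques-peel G {inside ∷ p} here = cong₂ _+_
  (cong (cliques (tail G)) (sym (p─⊥≡p p)))
  (cong (λ s → cliques G (s ∷ (p ∩ N₀ G))) (sym (irrefl G zero)))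
cliques-peel G {outside ∷ p} (there x∈p) = cliques-peel (tail G) x∈p
cliques-peel {x = suc x} G {inside ∷ p} (there x∈p) with adj G (suc x) zero in eq
... | true = begin
    cliques G₁ p + cliques G₁ (p ∩ N₀ G)
      ≡⟨ cong₂ _+_ (cliques-peel G₁ x∈p) (cliques-peel G₁ (x∈p∩q⁺ (x∈p , ∈-tabulate⁺ (Adj-sym G eq)))) ⟩
    (cliques G₁ (p - x) + cliques G₁ (p ∩ N G₁ x)) + (cliques G₁ (p ∩ N₀ G - x) + cliques G₁ ((p ∩ N₀ G) ∩ N G₁ x))
      ≡⟨ cong₂ (λ q r → (cliques G₁ (p - x) + cliques G₁ (p ∩ N G₁ x)) + (cliques G₁ q + cliques G₁ r)) (∩-- p (N₀ G)) swap∩ ⟩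
    (cliques G₁ (p - x) + cliques G₁ (p ∩ N G₁ x)) + (cliques G₁ ((p - x) ∩ N₀ G) + cliques G₁ ((p ∩ N G₁ x) ∩ N₀ G))
      ≡⟨ interchange (cliques G₁ (p - x)) _ _ _ ⟩
    (cliques G₁ (p - x) + cliques G₁ ((p - x) ∩ N₀ G)) + (cliques G₁ (p ∩ N G₁ x) + cliques G₁ ((p ∩ N G₁ x) ∩ N₀ G)) ∎
  where
  open ≡-Reasoning
  G₁ = tail G
  interchange : ∀ a b c d → (a + b) + (c + d) ≡ (a + c) + (b + d)
  interchange = solve-∀
  ∩-- : ∀ {n} {x : Fin n} (p q : Subset n) → p ∩ q - x ≡ (p - x) ∩ q
  ∩-- {x = x} p q = ⊆-antisym
    (λ z∈ → let z∈∩ , z≢x = x∈p-y⁻ (p ∩ q) x z∈ ; z∈p , z∈q = x∈p∩q⁻ p q z∈∩ in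
            x∈p∩q⁺ (x∈p∧x≢y⇒x∈p-y z∈p z≢x , z∈q))
    (λ z∈ → let z∈p-x , z∈q = x∈p∩q⁻ (p - x) q z∈ ; z∈p , z≢x = x∈p-y⁻ p x z∈p-x in
            x∈p∧x≢y⇒x∈p-y (x∈p∩q⁺ (z∈p , z∈q)) z≢x)
  swap∩ : (p ∩ N₀ G) ∩ N G₁ x ≡ (p ∩ N G₁ x) ∩ N₀ G
  swap∩ = trans (∩-assoc p _ _) (trans (cong (p ∩_) (∩-comm (N₀ G) (N G₁ x))) (sym (∩-assoc p _ _)))
... | false = begin
    cliques G₁ p + cliques G₁ (p ∩ N₀ G)
      ≡⟨ cong₂ _+_ (cliques-peel G₁ x∈p) (cong (cliques G₁) (⊆-antisym ⊆₁ (∩-⊆ (p - x) (N₀ G) (p─q⊆p p ⁅ x ⁆) id))) ⟩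
    (cliques G₁ (p - x) + cliques G₁ (p ∩ N G₁ x)) + cliques G₁ ((p - x) ∩ N₀ G)
      ≡⟨ swap+ (cliques G₁ (p - x)) _ _ ⟩
    (cliques G₁ (p - x) + cliques G₁ ((p - x) ∩ N₀ G)) + cliques G₁ (p ∩ N G₁ x) ∎
  where
  open ≡-Reasoning
  G₁ = tail G
  swap+ : ∀ a b c → (a + b) + c ≡ (a + c) + b
  swap+ = solve-∀
  ⊆₁ : p ∩ N₀ G ⊆ (p - x) ∩ N₀ G
  ⊆₁ z∈ with x∈p∩q⁻ p (N₀ G) z∈
  ... | z∈p , z∈N = x∈p∩q⁺ (x∈p∧x≢y⇒x∈p-y z∈p (λ { refl → contradiction (trans (sym eq) (Adj-sym G (∈-tabulate⁻ z∈N))) λ () }) , z∈N)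

cliques≤2^∣p∣ : ∀ (G : Graph n) p → cliques G p ≤ 2 ^ ∣ p ∣
cliques≤2^∣p∣ G [] = ≤-refl
cliques≤2^∣p∣ G (outside ∷ p) = cliques≤2^∣p∣ (tail G) p
cliques≤2^∣p∣ G (inside ∷ p) = +-mono-≤ (cliques≤2^∣p∣ (tail G) p)
  (≤-trans (cliques≤2^∣p∣ (tail G) (p ∩ N₀ G))
    (≤-trans (^-monoʳ-≤ 2 (∣p∩q∣≤∣p∣ p (N₀ G))) (m≤m+n _ 0)))

private
  +-interchange-≤ : ∀ a b c d a′ b′ c′ d′ → a + c ≤ a′ + c′ → b + d ≤ b′ + d′ →
                    (a + b) + (c + d) ≤ (a′ + b′) + (c′ + d′)
  +-interchange-≤ a b c d a′ b′ c′ d′ p q = subst₂ _≤_ (eq a c b d) (eq a′ c′ b′ d′) (+-mono-≤ p q)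
    where
    eq : ∀ a b c d → (a + b) + (c + d) ≡ (a + c) + (b + d)
    eq = solve-∀

  +-shuffleˡ-≤ : ∀ a b c a′ b′ c′ → a + c ≤ a′ + c′ → b ≤ b′ → (a + b) + c ≤ (a′ + b′) + c′
  +-shuffleˡ-≤ a b c a′ b′ c′ p q = subst₂ _≤_ (eq a c b) (eq a′ c′ b′) (+-mono-≤ p q)
    where
    eq : ∀ a c b → (a + c) + b ≡ (a + b) + c
    eq = solve-∀

  +-shuffleʳ-≤ : ∀ a b c a′ b′ c′ → a + c ≤ a′ + c′ → b ≤ b′ → a + (c + b) ≤ (a′ + b′) + c′
  +-shuffleʳ-≤ a b c a′ b′ c′ p q = subst₂ _≤_ (+-assoc a c b) (eq a′ c′ b′) (+-mono-≤ p q)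
    where
    eq : ∀ a c b → (a + c) + b ≡ (a + b) + c
    eq = solve-∀

∩-distrib-∩ : ∀ (p q r : Subset n) → (p ∩ q) ∩ r ≡ (p ∩ r) ∩ (q ∩ r)
∩-distrib-∩ p q r = ⊆-antisym
  (λ z → let z∈ , z∈r = x∈p∩q⁻ (p ∩ q) r z ; z∈p , z∈q = x∈p∩q⁻ p q z∈ in
         x∈p∩q⁺ (x∈p∩q⁺ (z∈p , z∈r) , x∈p∩q⁺ (z∈q , z∈r)))
  (λ z → let z∈₁ , z∈₂ = x∈p∩q⁻ (p ∩ r) (q ∩ r) z ; z∈p , z∈r = x∈p∩q⁻ p r z∈₁ ; z∈q , _ = x∈p∩q⁻ q r z∈₂ in
         x∈p∩q⁺ (x∈p∩q⁺ (z∈p , z∈q) , z∈r))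

-- A clique inside `p` or inside `q` lies inside `p ∪ q`, and only those inside `p ∩ q` are counted
-- twice on the left.
cliques-supermodular : ∀ (G : Graph n) p q → cliques G p + cliques G q ≤ cliques G (p ∪ q) + cliques G (p ∩ q)
cliques-supermodular G [] [] = ≤-refl
cliques-supermodular G (s ∷ p) (t ∷ q) = go s t
  where
  G₁ = tail G
  c = cliques G₁
  go : ∀ s t → cliques G (s ∷ p) + cliques G (t ∷ q) ≤ cliques G ((s ∷ p) ∪ (t ∷ q)) + cliques G ((s ∷ p) ∩ (t ∷ q))
  go outside outside = cliques-supermodular G₁ p q
  go inside inside =
    +-interchange-≤ (c p) _ (c q) _ (c (p ∪ q)) _ (c (p ∩ q)) _ (cliques-supermodular G₁ p q)
      (subst₂ (λ r s → c (p ∩ N₀ G) + c (q ∩ N₀ G) ≤ c r + c s)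
        (sym (∩-distribʳ-∪ (N₀ G) p q)) (sym (∩-distrib-∩ p q (N₀ G)))
        (cliques-supermodular G₁ (p ∩ N₀ G) (q ∩ N₀ G)))
  go inside outside = +-shuffleˡ-≤ (c p) _ (c q) (c (p ∪ q)) _ (c (p ∩ q))
    (cliques-supermodular G₁ p q) (cliques-⊆ G₁ (∩-⊆ p (N₀ G) (p⊆p∪q q) id))
  go outside inside = +-shuffleʳ-≤ (c p) _ (c q) (c (p ∪ q)) _ (c (p ∩ q))
    (cliques-supermodular G₁ p q) (cliques-⊆ G₁ (∩-⊆ q (N₀ G) (q⊆p∪q p q) id))

-- The hypothesis says that no edge joins p ─ q to q ─ p.
cliques-separation : ∀ (G : Graph n) p q →
  (∀ {x y} → x ∈ p → y ∈ q → Adj G x y → x ∈ q ⊎ y ∈ p) →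
  cliques G (p ∪ q) + cliques G (p ∩ q) ≤ cliques G p + cliques G q
cliques-separation G [] [] sep = ≤-refl
cliques-separation G (s ∷ p) (t ∷ q) sep = go s t sep
  where
  G₁ = tail G
  c = cliques G₁
  drop : ∀ {s t} → (∀ {x y} → x ∈ s ∷ p → y ∈ t ∷ q → Adj G x y → x ∈ t ∷ q ⊎ y ∈ s ∷ p) →
         ∀ {x y} → x ∈ p → y ∈ q → Adj G₁ x y → x ∈ q ⊎ y ∈ p
  drop sep x∈p y∈q xy with sep (there x∈p) (there y∈q) xy
  ... | inj₁ (there x∈q) = inj₁ x∈q
  ... | inj₂ (there y∈p) = inj₂ y∈p
  go : ∀ s t → (∀ {x y} → x ∈ s ∷ p → y ∈ t ∷ q → Adj G x y → x ∈ t ∷ q ⊎ y ∈ s ∷ p) →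
       cliques G ((s ∷ p) ∪ (t ∷ q)) + cliques G ((s ∷ p) ∩ (t ∷ q)) ≤ cliques G (s ∷ p) + cliques G (t ∷ q)
  go outside outside sep = cliques-separation G₁ p q (drop sep)
  go inside inside sep = +-interchange-≤ (c (p ∪ q)) _ (c (p ∩ q)) _ (c p) _ (c q) _
    (cliques-separation G₁ p q (drop sep))
    (subst₂ (λ r s → c r + c s ≤ c (p ∩ N₀ G) + c (q ∩ N₀ G))
      (sym (∩-distribʳ-∪ (N₀ G) p q)) (sym (∩-distrib-∩ p q (N₀ G)))
      (cliques-separation G₁ (p ∩ N₀ G) (q ∩ N₀ G) sep∩))
    where
    sep∩ : ∀ {x y} → x ∈ p ∩ N₀ G → y ∈ q ∩ N₀ G → Adj G₁ x y → x ∈ q ∩ N₀ G ⊎ y ∈ p ∩ N₀ G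
    sep∩ x∈ y∈ xy with x∈p∩q⁻ p (N₀ G) x∈ | x∈p∩q⁻ q (N₀ G) y∈
    ... | x∈p , x∈N | y∈q , y∈N with drop sep x∈p y∈q xy
    ... | inj₁ x∈q = inj₁ (x∈p∩q⁺ (x∈q , x∈N))
    ... | inj₂ y∈p = inj₂ (x∈p∩q⁺ (y∈p , y∈N))
  go inside outside sep = +-shuffleˡ-≤ (c (p ∪ q)) _ (c (p ∩ q)) (c p) _ (c q)
    (cliques-separation G₁ p q (drop sep)) (cliques-⊆ G₁ ⊆p)
    where
    ⊆p : (p ∪ q) ∩ N₀ G ⊆ p ∩ N₀ G
    ⊆p x∈ with x∈p∩q⁻ (p ∪ q) (N₀ G) x∈
    ... | x∈∪ , x∈N with x∈p∪q⁻ p q x∈∪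
    ... | inj₁ x∈p = x∈p∩q⁺ (x∈p , x∈N)
    ... | inj₂ x∈q with sep here (there x∈q) (∈-tabulate⁻ x∈N)
    ... | inj₂ (there x∈p) = x∈p∩q⁺ (x∈p , x∈N)
  go outside inside sep = ≤-trans
    (+-shuffleˡ-≤ (c (p ∪ q)) _ (c (p ∩ q)) (c p) _ (c q) (cliques-separation G₁ p q (drop sep)) (cliques-⊆ G₁ ⊆q))
    (≤-reflexive (eq (c p) _ _))
    where
    eq : ∀ a b c → (a + b) + c ≡ a + (c + b)
    eq = solve-∀
    ⊆q : (p ∪ q) ∩ N₀ G ⊆ q ∩ N₀ G
    ⊆q x∈ with x∈p∩q⁻ (p ∪ q) (N₀ G) x∈
    ... | x∈∪ , x∈N with x∈p∪q⁻ p q x∈∪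
    ... | inj₂ x∈q = x∈p∩q⁺ (x∈q , x∈N)
    ... | inj₁ x∈p with sep (there x∈p) here (Adj-sym G (∈-tabulate⁻ x∈N))
    ... | inj₁ (there x∈q) = x∈p∩q⁺ (x∈q , x∈N)

-- Contraction of an edge

is : Fin n → Fin n → Bool
is u x = isYes (x ≟ u)

is-refl : ∀ (u : Fin n) → is u u ≡ true
is-refl u with u ≟ u
... | yes _ = refl
... | no u≢u = contradiction refl u≢u

is-≢ : x ≢ y → is y x ≡ false
is-≢ {x = x} {y} x≢y with x ≟ y
... | yes x≡y = contradiction x≡y x≢y
... | no _ = refl

is-sym : ∀ (x y : Fin n) → is x y ≡ is y x
is-sym x y with x ≟ y | y ≟ x
... | yes _ | yes _ = refl
... | no _ | no _ = refl
... | yes x≡y | no y≢x = contradiction (sym x≡y) y≢x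
... | no x≢y | yes y≡x = contradiction (sym y≡x) x≢y

-- Merges v into u.  Here v is not removed: it has to be taken out of the vertex set separately.
contract : Graph n → Fin n → Fin n → Graph n
contract G u v = record
  { adj = λ x y → not (is x y) ∧ (adj G x y ∨ ((is u x ∧ adj G v y) ∨ (is u y ∧ adj G v x)))
  ; sym = λ x y → cong₂ _∧_ (cong not (is-sym x y))
            (cong₂ _∨_ (adj-sym G x y) (∨-comm (is u x ∧ adj G v y) (is u y ∧ adj G v x)))
  ; irrefl = λ x → cong (λ b → not b ∧ (adj G x x ∨ ((is u x ∧ adj G v x) ∨ (is u x ∧ adj G v x)))) (is-refl x) }

module _ (G : Graph n) {u v : Fin n} where

  contract-⊇ : Adj G x y → Adj (contract G u v) x y
  contract-⊇ {x} {y} xy rewrite is-≢ {x = y} {x} (λ y≡x → Adj⇒≢ G xy (sym y≡x)) | xy = refl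

  contract-merged : Adj G v y → y ≢ u → Adj (contract G u v) u y
  contract-merged {y} vy y≢u rewrite is-≢ y≢u | is-refl u | vy with adj G u y
  ... | true = refl
  ... | false = refl

  contract-⊆ : Adj (contract G u v) x y → Adj G x y ⊎ (x ≡ u × Adj G v y) ⊎ (y ≡ u × Adj G v x)
  contract-⊆ {x} {y} xy with is x y | adj G x y | x ≟ u | adj G v y in vy | y ≟ u | adj G v x in vx
  ... | false | true | _ | _ | _ | _ = inj₁ refl
  ... | false | false | yes x≡u | true | _ | _ = inj₂ (inj₁ (x≡u , refl))
  ... | false | false | _ | _ | yes y≡u | true = inj₂ (inj₂ (y≡u , refl))
  contract-⊆ () | false | false | yes _ | false | yes _ | false
  contract-⊆ () | false | false | yes _ | false | no _ | _
  contract-⊆ () | false | false | no _ | _ | yes _ | false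
  contract-⊆ () | false | false | no _ | _ | no _ | _

  contract-⊆′ : x ≢ u → y ≢ u → Adj (contract G u v) x y → Adj G x y
  contract-⊆′ x≢u y≢u xy with contract-⊆ xy
  ... | inj₁ xy′ = xy′
  ... | inj₂ (inj₁ (x≡u , _)) = contradiction x≡u x≢u
  ... | inj₂ (inj₂ (y≡u , _)) = contradiction y≡u y≢u

  -- K ∪ {u}, K ∪ {v} and K ∪ {u , v} become the same clique exactly when K lies in N(u) ∩ N(v).
  cliques-contract : ∀ {p} → u ∈ p → v ∈ p → Adj G u v →
    cliques G p ≤ cliques (contract G u v) (p - v) + 2 * cliques G ((p ∩ N G u) ∩ N G v)
  cliques-contract {p} u∈p v∈p uv = begin
    c p
      ≡⟨ cliques-peel G v∈p ⟩
    c (p - v) + c (p ∩ N G v)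
      ≡⟨ cong₂ _+_ (cliques-peel G (x∈p∧x≢y⇒x∈p-y u∈p (Adj⇒≢ G uv)))
                   (cliques-peel G (∈-p∩N⁺ G u∈p (Adj-sym G uv))) ⟩
    -- The terms count the cliques with neither end, only `u`, only `v`, and both. Merging can
    -- identify only members of the middle two, and the coincidences lie in `A ∩ B`. The factor 2
    -- arises because `c W` bounds both these coincidences and the last term.
    (c (p - v - u) + c A) + (c B + c ((p ∩ N G v) ∩ N G u))
      ≡⟨ shuffle (c (p - v - u)) _ _ _ ⟩
    (c (p - v - u) + (c A + c B)) + c ((p ∩ N G v) ∩ N G u)
      ≤⟨ +-monoˡ-≤ _ (+-monoʳ-≤ (c (p - v - u)) (cliques-supermodular G A B)) ⟩
    (c (p - v - u) + (c (A ∪ B) + c (A ∩ B))) + c ((p ∩ N G v) ∩ N G u)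
      ≤⟨ +-mono-≤ (+-mono-≤ (cliques-mono G G′ {p - v - u} id (λ _ _ → contract-⊇))
           (+-mono-≤ (cliques-mono G G′ A∪B⊆ (λ _ _ → contract-⊇)) (cliques-⊆ G A∩B⊆))) (cliques-⊆ G swap⊆) ⟩
    (cliques G′ (p - v - u) + (cliques G′ ((p - v) ∩ N G′ u) + c W)) + c W
      ≡⟨ shuffle′ (cliques G′ (p - v - u)) _ _ ⟩
    (cliques G′ (p - v - u) + cliques G′ ((p - v) ∩ N G′ u)) + 2 * c W
      ≡⟨ cong (_+ 2 * c W) (cliques-peel G′ (x∈p∧x≢y⇒x∈p-y u∈p (Adj⇒≢ G uv))) ⟨
    cliques G′ (p - v) + 2 * c W ∎
    where
    open ≤-Reasoning
    c = cliques G
    G′ = contract G u v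
    A = (p - v) ∩ N G u
    B = p ∩ N G v - u
    W = (p ∩ N G u) ∩ N G v
    shuffle : ∀ a b d e → (a + b) + (d + e) ≡ (a + (b + d)) + e
    shuffle = solve-∀
    shuffle′ : ∀ a b w → (a + (b + w)) + w ≡ (a + b) + 2 * w
    shuffle′ = solve-∀
    A∪B⊆ : A ∪ B ⊆ (p - v) ∩ N G′ u
    A∪B⊆ x∈ with x∈p∪q⁻ A B x∈
    ... | inj₁ x∈A = let x∈p-v , ux = ∈-p∩N⁻ G (p - v) x∈A in ∈-p∩N⁺ G′ x∈p-v (contract-⊇ ux)
    ... | inj₂ x∈B = let x∈∩ , x≢u = x∈p-y⁻ (p ∩ N G v) u x∈B ; x∈p , vx = ∈-p∩N⁻ G p x∈∩ in
      ∈-p∩N⁺ G′ (x∈p∧x≢y⇒x∈p-y x∈p (λ x≡v → Adj⇒≢ G vx (sym x≡v))) (contract-merged vx x≢u)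
    A∩B⊆ : A ∩ B ⊆ W
    A∩B⊆ x∈ = let x∈A , x∈B = x∈p∩q⁻ A B x∈
                  x∈p-v , ux = ∈-p∩N⁻ G (p - v) x∈A
                  x∈∩ , x≢u = x∈p-y⁻ (p ∩ N G v) u x∈B
                  x∈p , vx = ∈-p∩N⁻ G p x∈∩
              in ∈-p∩N⁺ G (∈-p∩N⁺ G x∈p ux) vx
    swap⊆ : (p ∩ N G v) ∩ N G u ⊆ W
    swap⊆ x∈ = let x∈∩ , ux = ∈-p∩N⁻ G (p ∩ N G v) x∈ ; x∈p , vx = ∈-p∩N⁻ G p x∈∩ in
               ∈-p∩N⁺ G (∈-p∩N⁺ G x∈p ux) vx

-- Agreement of `cliques` with `numCliques`

Clique : Graph n → Subset n → Set
Clique G p = ∀ {x y} → x ∈ p → y ∈ p → x ≢ y → Adj G x y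

-- With the test `f` arbitrary, fixing the first entry of the vector gives an instance of the same
-- kind: `f ∘ (false ∷_)` and `f ∘ (true ∷_)` test for cliques of the tail in `p` and in `p ∩ N₀ G`.
count-cliques : ∀ (G : Graph n) p (f : Vec Bool n → Bool) →
  (∀ S → T (f S) → Clique G S × S ⊆ p) → (∀ S → Clique G S → S ⊆ p → T (f S)) →
  length (filter (λ S → T? (f S)) (allSubsets n)) ≡ cliques G p
count-cliques G [] f sound complete with f [] | complete [] (λ ()) (λ ())
... | true | _ = refl
count-cliques {suc n} G (s ∷ p) f sound complete = begin
  length (filter f? (map (true ∷_) subs ++ map (false ∷_) subs))
    ≡⟨ cong length (filter-++ f? (map (true ∷_) subs) _) ⟩
  length (filter f? (map (true ∷_) subs) ++ filter f? (map (false ∷_) subs))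
    ≡⟨ length-++ (filter f? (map (true ∷_) subs)) ⟩
  length (filter f? (map (true ∷_) subs)) + length (filter f? (map (false ∷_) subs))
    ≡⟨ +-comm (length (filter f? (map (true ∷_) subs))) _ ⟩
  length (filter f? (map (false ∷_) subs)) + length (filter f? (map (true ∷_) subs))
    ≡⟨ cong₂ _+_ (length-filter-map (false ∷_) subs) (length-filter-map (true ∷_) subs) ⟩
  length (filter (f? ∘ (false ∷_)) subs) + length (filter (f? ∘ (true ∷_)) subs)
    ≡⟨ cong (_+ length (filter (f? ∘ (true ∷_)) subs)) without ⟩
  cliques (tail G) p + length (filter (f? ∘ (true ∷_)) subs)
    ≡⟨ with₀ s sound complete ⟩
  cliques G (s ∷ p) ∎
  where
  open ≡-Reasoning
  subs = allSubsets n
  f? = λ S → T? (f S)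

  length-filter-map : ∀ (g : Vec Bool n → Vec Bool (suc n)) xs →
    length (filter f? (map g xs)) ≡ length (filter (f? ∘ g) xs)
  length-filter-map g [] = refl
  length-filter-map g (x ∷ xs) with f (g x)
  ... | true = cong suc (length-filter-map g xs)
  ... | false = length-filter-map g xs

  Clique-tail : ∀ {b S} → Clique G (b ∷ S) → Clique (tail G) S
  Clique-tail cl x∈ y∈ x≢y = cl (there x∈) (there y∈) λ { refl → x≢y refl }

  without : length (filter (f? ∘ (false ∷_)) subs) ≡ cliques (tail G) p
  without = count-cliques (tail G) p (f ∘ (false ∷_))
    (λ S t → let cl , S⊆ = sound (false ∷ S) t in Clique-tail {false} cl , drop-∷-⊆ {s = false} S⊆)
    (λ S cl S⊆ → complete (false ∷ S)
      (λ { (there x∈) (there y∈) x≢y → cl x∈ y∈ (x≢y ∘ cong suc) }) (out⊆ S⊆))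

  none : (∀ S → ¬ T (f (true ∷ S))) → ∀ xs → length (filter (f? ∘ (true ∷_)) xs) ≡ 0
  none no-S [] = refl
  none no-S (S ∷ xs) with f (true ∷ S) | no-S S
  ... | true | ¬t = contradiction _ ¬t
  ... | false | _ = none no-S xs

  with₀ : ∀ s → (∀ S → T (f S) → Clique G S × S ⊆ s ∷ p) → (∀ S → Clique G S → S ⊆ s ∷ p → T (f S)) →
          cliques (tail G) p + length (filter (f? ∘ (true ∷_)) subs) ≡ cliques G (s ∷ p)
  with₀ outside sound complete = trans
    (cong (cliques (tail G) p +_) (none (λ S t → case proj₂ (sound (true ∷ S) t) here of λ ()) subs))
    (+-identityʳ _)
  with₀ inside sound complete = cong (cliques (tail G) p +_) (count-cliques (tail G) (p ∩ N₀ G) (f ∘ (true ∷_))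
    (λ S t → let cl , S⊆ = sound (true ∷ S) t in Clique-tail {true} cl ,
      λ x∈ → x∈p∩q⁺ (drop-∷-⊆ S⊆ x∈ , ∈-tabulate⁺ (cl here (there x∈) λ ())))
    (λ S cl S⊆ → complete (true ∷ S) (extend S cl S⊆) (in⊆in (λ x∈ → p∩q⊆p p (N₀ G) (S⊆ x∈)))))
    where
    extend : ∀ S → Clique (tail G) S → S ⊆ p ∩ N₀ G → Clique G (true ∷ S)
    extend S cl S⊆ here here x≢y = contradiction refl x≢y
    extend S cl S⊆ here (there y∈) x≢y = ∈-tabulate⁻ (p∩q⊆q p (N₀ G) (S⊆ y∈))
    extend S cl S⊆ (there x∈) here x≢y = Adj-sym G (∈-tabulate⁻ (p∩q⊆q p (N₀ G) (S⊆ x∈)))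
    extend S cl S⊆ (there x∈) (there y∈) x≢y = cl x∈ y∈ (x≢y ∘ cong suc)

T-allFinB : ∀ n (f : Fin n → Bool) → T (allFinB n f) ⇔ (∀ i → T (f i))
T-allFinB zero f = mk⇔ (λ _ ()) _
T-allFinB (suc n) f = mk⇔
  (λ t → let t₀ , t₁ = Equivalence.to T-∧ t in
    λ { zero → t₀ ; (suc i) → Equivalence.to (T-allFinB n (f ∘ suc)) t₁ i })
  (λ h → Equivalence.from T-∧ (h zero , Equivalence.from (T-allFinB n (f ∘ suc)) (h ∘ suc)))

isClique-sound : ∀ (G : Graph n) S → T (isClique G S) → Clique G S
isClique-sound {n} G S t {x} {y} x∈ y∈ x≢y = to ([]=⇒lookup x∈) ([]=⇒lookup y∈)
  (Equivalence.to (T-allFinB n _) (Equivalence.to (T-allFinB n _) t x) y)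
  where
  to : lookup S x ≡ true → lookup S y ≡ true →
       T (if lookup S x ∧ lookup S y ∧ not (isYes (x ≟ y)) then adj G x y else true) → Adj G x y
  to Sx Sy t rewrite Sx | Sy with x ≟ y
  ... | yes x≡y = contradiction x≡y x≢y
  ... | no _ = Equivalence.to T-≡ t

isClique-complete : ∀ (G : Graph n) S → Clique G S → T (isClique G S)
isClique-complete {n} G S cl =
  Equivalence.from (T-allFinB n _) λ x → Equivalence.from (T-allFinB n _) λ y → from x y
  where
  from : ∀ x y → T (if lookup S x ∧ lookup S y ∧ not (isYes (x ≟ y)) then adj G x y else true)
  from x y with lookup S x in Sx | lookup S y in Sy | x ≟ y
  ... | false | _ | _ = _
  ... | true | false | _ = _
  ... | true | true | yes _ = _
  ... | true | true | no x≢y = Equivalence.from T-≡ (cl (lookup⇒[]= x S Sx) (lookup⇒[]= y S Sy) x≢y)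

numCliques≡cliques : ∀ (G : Graph n) → numCliques G ≡ cliques G ⊤
numCliques≡cliques G = count-cliques G ⊤ (isClique G)
  (λ S t → isClique-sound G S t , ⊆⊤) (λ S cl _ → isClique-complete G S cl)

-- Walks, components and minor models

module _ {G : Graph n} where

  walk-map : ∀ {P Q : Fin n → Set} → (∀ {w} → P w → Q w) → Connected G P x y → Connected G Q x y
  walk-map P⇒Q here = here
  walk-map P⇒Q (step xv Pv w) = step xv (P⇒Q Pv) (walk-map P⇒Q w)

  walk-++ : ∀ {P : Fin n → Set} {x y z} → Connected G P x y → Connected G P y z → Connected G P x z
  walk-++ here w′ = w′
  walk-++ (step xv Pv w) w′ = step xv Pv (walk-++ w w′)

  -- `Connected` imposes its condition on every vertex of the walk except the first. Reversal makes
  -- that vertex the last, hence the hypothesis `P x`.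
  walk-reverse : ∀ {P : Fin n → Set} → P x → Connected G P x y → Connected G P y x
  walk-reverse Px here = here
  walk-reverse Px (step xv Pv w) = walk-++ (walk-reverse Pv w) (step (Adj-sym G xv) Px here)

  -- Cuts the walk at its first arrival at `y`. Doing this at both ends isolates the interior of a
  -- path.
  walk-before : ∀ {p} → Connected G (_∈ p) x y → x ≢ y →
                ∃ λ z → Adj G z y × Connected G (_∈ p - y) x z
  walk-before here x≢x = contradiction refl x≢x
  walk-before {x} {y} (step {v = v} xv v∈p w) x≢y with v ≟ y
  ... | yes refl = x , xv , here
  ... | no v≢y with walk-before w v≢y
  ... | z , zy , w′ = z , zy , step xv (x∈p∧x≢y⇒x∈p-y v∈p v≢y) w′

ConnectedSet : Graph n → Subset n → Set
ConnectedSet G C = ∀ {x y} → x ∈ C → y ∈ C → Connected G (_∈ C) x y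

ConnectedSet-⁅⁆ : ∀ (G : Graph n) x → ConnectedSet G ⁅ x ⁆
ConnectedSet-⁅⁆ G x y∈ z∈ with refl ← x∈⁅y⁆⇒x≡y x y∈ | refl ← x∈⁅y⁆⇒x≡y x z∈ = here

record Component (G : Graph n) (p : Subset n) (w : Fin n) : Set where
  field
    set       : Subset n
    ⊆p        : set ⊆ p
    root      : w ∈ set
    connected : ConnectedSet G set
    closed    : ∀ {x y} → x ∈ set → y ∈ p → Adj G x y → y ∈ set

  closed-walk : ∀ {x y} → x ∈ set → Connected G (_∈ p) x y → y ∈ set
  closed-walk x∈ here = x∈
  closed-walk x∈ (step xv v∈p w) = closed-walk (closed x∈ v∈p xv) w

abstract
  component : ∀ (G : Graph n) {p w} → w ∈ p → Component G p w
  component {n} G {p} {w} w∈p =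
    grow n ⁅ w ⁆ (m≤n+m n _) (λ x∈ → subst (_∈ p) (sym (x∈⁅y⁆⇒x≡y w x∈)) w∈p) (x∈⁅x⁆ w)
      (ConnectedSet-⁅⁆ G w (x∈⁅x⁆ w))
    where
    -- `k` bounds the number of vertices outside `C`. Each round moves one of them into `C`, so at
    -- zero there is none left to add.
    grow : ∀ k C → n ≤ ∣ C ∣ + k → C ⊆ p → w ∈ C → (∀ {x} → x ∈ C → Connected G (_∈ C) w x) → Component G p w
    grow k C bound C⊆p w∈C reach
      with any? (λ x → any? λ y → (x ∈? C) ×-dec (y ∈? p) ×-dec (¬? (y ∈? C)) ×-dec (adj G x y Bool.≟ true))
    ... | no none = record
      { set = C ; ⊆p = C⊆p ; root = w∈C
      ; connected = λ x∈ y∈ → walk-++ (walk-reverse w∈C (reach x∈)) (reach y∈)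
      ; closed = λ {x} {y} x∈ y∈p xy → case y ∈? C of λ where
          (yes y∈C) → y∈C
          (no y∉C) → contradiction (x , y , x∈ , y∈p , y∉C , xy) none }
    grow zero C bound C⊆p w∈C reach | yes (x , y , x∈ , y∈p , y∉C , xy) =
      contradiction (≤-trans (≤-reflexive (sym (∣p⊕x∣≡1+∣p∣ y∉C)))
        (≤-trans (∣p∣≤n (C ⊕ y)) (≤-trans bound (≤-reflexive (+-identityʳ _))))) 1+n≰n
    grow (suc k) C bound C⊆p w∈C reach | yes (x , y , x∈ , y∈p , y∉C , xy) =
      grow k (C ⊕ y) (≤-trans bound (≤-reflexive (trans (+-suc _ k) (cong (_+ k) (sym (∣p⊕x∣≡1+∣p∣ y∉C))))))
        (⊕-elim (_∈ p) C C⊆p y∈p) (C⊆ w∈C)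
        (⊕-elim (Connected G (_∈ C ⊕ y) w) C (λ z∈ → walk-map C⊆ (reach z∈))
          (walk-++ (walk-map C⊆ (reach x∈)) (step xy (x∈p⊕x C y) here)))
      where
      C⊆ : C ⊆ C ⊕ y
      C⊆ = p⊆p⊕x C y

-- A minor of the subgraph induced on `p`, expressed without changing the vertex type.
record K33-minor-in (G : Graph n) (p : Subset n) : Set where
  field
    model   : IsMinor K33 G
    support : ∀ {w i} → MinorModel.branch model w ≡ just i → w ∈ p

K33-⊆ : ∀ {G : Graph n} {p q} → p ⊆ q → K33-minor-in G p → K33-minor-in G q
K33-⊆ p⊆q m = record { model = model ; support = λ eq → p⊆q (support eq) }
  where open K33-minor-in m

-- The model in `p - v` leaves `v` unassigned, so `v` can join whatever branch set `u` belongs to.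
-- An edge at `u` that is new in the contraction is an edge at `v` in `G`, and walks take the detour
-- through `v`.
K33-contract : ∀ (G : Graph n) {p u v} → u ∈ p → v ∈ p → Adj G u v →
               K33-minor-in (contract G u v) (p - v) → K33-minor-in G p
K33-contract {n} G {p} {u} {v} u∈p v∈p uv m = record
  { model = record
    { branch = branch
    ; nonempty = λ i → let w , eq = M.nonempty i in w , lift-branch eq
    ; connected = connected
    ; edges = edges }
  ; support = support }
  where
  open K33-minor-in m using (model) renaming (support to support′)
  module M = MinorModel model

  branch : Fin n → Maybe (Fin 6)
  branch w with w ≟ v
  ... | yes _ = M.branch u
  ... | no _ = M.branch w

  ≢v : ∀ {w i} → M.branch w ≡ just i → w ≢ v
  ≢v eq = proj₂ (x∈p-y⁻ p v (support′ eq))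

  lift-branch : ∀ {w i} → M.branch w ≡ just i → branch w ≡ just i
  lift-branch {w} eq with w ≟ v
  ... | yes w≡v = contradiction w≡v (≢v eq)
  ... | no _ = eq

  branch-v : branch v ≡ M.branch u
  branch-v with v ≟ v
  ... | yes _ = refl
  ... | no v≢v = contradiction refl v≢v

  support : ∀ {w i} → branch w ≡ just i → w ∈ p
  support {w} eq with w ≟ v
  ... | yes refl = v∈p
  ... | no _ = p─q⊆p p ⁅ v ⁆ (support′ eq)

  lift-walk : ∀ {i x y} → M.branch x ≡ just i →
              Connected (contract G u v) (λ w → M.branch w ≡ just i) x y →
              Connected G (λ w → branch w ≡ just i) x y
  lift-walk Bx here = here
  lift-walk Bx (step xz Bz w) with contract-⊆ G xz
  ... | inj₁ xz′ = step xz′ (lift-branch Bz) (lift-walk Bz w)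
  ... | inj₂ (inj₁ (refl , vz)) = step uv (trans branch-v Bx) (step vz (lift-branch Bz) (lift-walk Bz w))
  ... | inj₂ (inj₂ (refl , vx)) =
    step (Adj-sym G vx) (trans branch-v Bz) (step (Adj-sym G uv) (lift-branch Bz) (lift-walk Bz w))

  to-old : ∀ {x i} → branch x ≡ just i →
           ∃ λ y → M.branch y ≡ just i × Connected G (λ w → branch w ≡ just i) x y
                                       × Connected G (λ w → branch w ≡ just i) y x
  to-old {x} eq with x ≟ v
  ... | yes refl = u , eq , step (Adj-sym G uv) (lift-branch eq) here , step uv (trans branch-v eq) here
  ... | no _ = x , eq , here , here

  connected : ∀ i x y → branch x ≡ just i → branch y ≡ just i → Connected G (λ w → branch w ≡ just i) x y
  connected i x y Bx By with to-old Bx | to-old By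
  ... | x′ , Bx′ , wx , _ | y′ , By′ , _ , wy =
    walk-++ wx (walk-++ (lift-walk Bx′ (M.connected i x′ y′ Bx′ By′)) wy)

  edges : ∀ i j → Adj K33 i j → ∃ λ x → ∃ λ y → branch x ≡ just i × branch y ≡ just j × Adj G x y
  edges i j ij with M.edges i j ij
  ... | x , y , Bx , By , xy with contract-⊆ G xy
  ... | inj₁ xy′ = x , y , lift-branch Bx , lift-branch By , xy′
  ... | inj₂ (inj₁ (refl , vy)) = v , y , trans branch-v Bx , lift-branch By , vy
  ... | inj₂ (inj₂ (refl , vx)) = x , v , lift-branch Bx , trans branch-v By , Adj-sym G vx

abstract
  K33-edge : ∀ i j → Adj K33 i j →
    (∃ λ (k : Fin 3) → ∃ λ (l : Fin 3) → i ≡ k ↑ˡ 3 × j ≡ 3 ↑ʳ l) ⊎ (∃ λ (k : Fin 3) → ∃ λ (l : Fin 3) → i ≡ 3 ↑ʳ l × j ≡ k ↑ˡ 3)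
  K33-edge = from-yes (all? λ i → all? λ j → (adj K33 i j Bool.≟ true) →-dec
    ((any? λ (k : Fin 3) → any? λ (l : Fin 3) → (i ≟ k ↑ˡ 3) ×-dec (j ≟ 3 ↑ʳ l)) ⊎-dec
     (any? λ (k : Fin 3) → any? λ (l : Fin 3) → (i ≟ 3 ↑ʳ l) ×-dec (j ≟ k ↑ˡ 3))))

K33-from-sets : ∀ (G : Graph n) {p} (B : Fin 6 → Subset n) →
  (∀ i → B i ⊆ p) → (∀ i → Nonempty (B i)) → (∀ i → ConnectedSet G (B i)) →
  (∀ {i j x} → x ∈ B i → x ∈ B j → i ≡ j) →
  (∀ (k l : Fin 3) → ∃ λ x → ∃ λ y → x ∈ B (k ↑ˡ 3) × y ∈ B (3 ↑ʳ l) × Adj G x y) →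
  K33-minor-in G p
K33-from-sets {n} G {p} B B⊆p B≠∅ conn disjoint edge = record
  { model = record
    { branch = branch
    ; nonempty = λ i → let x , x∈ = B≠∅ i in x , branch⁺ x∈
    ; connected = λ i x y Bx By → walk-map branch⁺ (conn i (branch⁻ Bx) (branch⁻ By))
    ; edges = edges }
  ; support = λ {_} {i} eq → B⊆p i (branch⁻ eq) }
  where
  branch : Fin n → Maybe (Fin 6)
  branch w with any? (λ i → w ∈? B i)
  ... | yes (i , _) = just i
  ... | no _ = nothing

  branch⁺ : ∀ {w i} → w ∈ B i → branch w ≡ just i
  branch⁺ {w} {i} w∈ with any? (λ i → w ∈? B i)
  ... | yes (j , w∈j) = cong just (disjoint w∈j w∈)
  ... | no none = contradiction (i , w∈) none

  branch⁻ : ∀ {w i} → branch w ≡ just i → w ∈ B i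
  branch⁻ {w} eq with any? (λ i → w ∈? B i)
  branch⁻ {w} refl | yes (j , w∈j) = w∈j

  edges : ∀ i j → Adj K33 i j → ∃ λ x → ∃ λ y → branch x ≡ just i × branch y ≡ just j × Adj G x y
  edges i j ij with K33-edge i j ij
  ... | inj₁ (k , l , refl , refl) = let x , y , x∈ , y∈ , xy = edge k l in
        x , y , branch⁺ x∈ , branch⁺ y∈ , xy
  ... | inj₂ (k , l , refl , refl) = let x , y , x∈ , y∈ , xy = edge k l in
        y , x , branch⁺ y∈ , branch⁺ x∈ , Adj-sym G xy

Disjoint : Subset n → Subset n → Set
Disjoint p q = ∀ {x} → x ∈ p → x ∉ q

lookup-disjoint : ∀ {m} {Bs : Vec (Subset n) m} → AllPairs Disjoint Bs →
                  ∀ {i j x} → x ∈ lookup Bs i → x ∈ lookup Bs j → i ≡ j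
lookup-disjoint (_ ∷ _) {zero} {zero} _ _ = refl
lookup-disjoint (d ∷ _) {zero} {suc j} x∈i x∈j = contradiction x∈j (lookup⁺ d j x∈i)
lookup-disjoint (d ∷ _) {suc i} {zero} x∈i x∈j = contradiction x∈i (lookup⁺ d i x∈j)
lookup-disjoint (_ ∷ ds) {suc i} {suc j} x∈i x∈j = cong suc (lookup-disjoint ds x∈i x∈j)

⁅x⁆-disjoint : ∀ {q : Subset n} → x ∉ q → Disjoint ⁅ x ⁆ q
⁅x⁆-disjoint {x = x} x∉q y∈ with refl ← x∈⁅y⁆⇒x≡y x y∈ = x∉q

⁅x⁆-⊆ : ∀ {p : Subset n} → x ∈ p → ⁅ x ⁆ ⊆ p
⁅x⁆-⊆ {x = x} x∈p y∈ with refl ← x∈⁅y⁆⇒x≡y x y∈ = x∈p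

module _ (G : Graph n) {p : Subset n} where

  SeesAll : Fin n → Fin n → Subset n → Fin n → Set
  SeesAll b₁ b₂ C a = Adj G a b₁ × Adj G a b₂ × a ∉ C × ∃ λ c → c ∈ C × Adj G a c

  -- Every K₃,₃ model built below has five singleton branch sets. The sixth set `C` is a single
  -- vertex, a component containing the interior of a path, or a component outside a K₅. All other
  -- models are pulled back from these by `K33-contract`.
  K33-with-set : ∀ {a₁ a₂ a₃ b₁ b₂ : Fin n} {C} →
    a₁ ∈ p → a₂ ∈ p → a₃ ∈ p → b₁ ∈ p → b₂ ∈ p → C ⊆ p → ConnectedSet G C →
    a₁ ≢ a₂ → a₁ ≢ a₃ → a₂ ≢ a₃ → b₁ ≢ b₂ → b₁ ∉ C → b₂ ∉ C →
    SeesAll b₁ b₂ C a₁ → SeesAll b₁ b₂ C a₂ → SeesAll b₁ b₂ C a₃ → K33-minor-in G p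
  K33-with-set {a₁} {a₂} {a₃} {b₁} {b₂} {C} a₁∈ a₂∈ a₃∈ b₁∈ b₂∈ C⊆ conn a₁≢a₂ a₁≢a₃ a₂≢a₃ b₁≢b₂ b₁∉C b₂∉C
    (a₁b₁ , a₁b₂ , a₁∉C , c₁ , c₁∈ , a₁c₁) (a₂b₁ , a₂b₂ , a₂∉C , c₂ , c₂∈ , a₂c₂)
    (a₃b₁ , a₃b₂ , a₃∉C , c₃ , c₃∈ , a₃c₃) =
    K33-from-sets G (lookup Bs)
      (lookup⁺ {P = _⊆ p} (⁅x⁆-⊆ a₁∈ ∷ ⁅x⁆-⊆ a₂∈ ∷ ⁅x⁆-⊆ a₃∈ ∷ ⁅x⁆-⊆ b₁∈ ∷ ⁅x⁆-⊆ b₂∈ ∷ C⊆ ∷ []))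
      (lookup⁺ {P = Nonempty} ((_ , x∈⁅x⁆ a₁) ∷ (_ , x∈⁅x⁆ a₂) ∷ (_ , x∈⁅x⁆ a₃) ∷
                           (_ , x∈⁅x⁆ b₁) ∷ (_ , x∈⁅x⁆ b₂) ∷ (_ , c₁∈) ∷ []))
      (lookup⁺ {P = ConnectedSet G}
        (ConnectedSet-⁅⁆ G a₁ ∷ ConnectedSet-⁅⁆ G a₂ ∷ ConnectedSet-⁅⁆ G a₃ ∷
         ConnectedSet-⁅⁆ G b₁ ∷ ConnectedSet-⁅⁆ G b₂ ∷ conn ∷ []))
      (lookup-disjoint
        ( ((a₁≢a₂ #) ∷ (a₁≢a₃ #) ∷ (Adj⇒≢ G a₁b₁ #) ∷ (Adj⇒≢ G a₁b₂ #) ∷ ⁅x⁆-disjoint a₁∉C ∷ [])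
        ∷ ((a₂≢a₃ #) ∷ (Adj⇒≢ G a₂b₁ #) ∷ (Adj⇒≢ G a₂b₂ #) ∷ ⁅x⁆-disjoint a₂∉C ∷ [])
        ∷ ((Adj⇒≢ G a₃b₁ #) ∷ (Adj⇒≢ G a₃b₂ #) ∷ ⁅x⁆-disjoint a₃∉C ∷ [])
        ∷ ((b₁≢b₂ #) ∷ ⁅x⁆-disjoint b₁∉C ∷ [])
        ∷ (⁅x⁆-disjoint b₂∉C ∷ [])
        ∷ [] ∷ []))
      edge
    where
    Bs : Vec (Subset n) 6
    Bs = ⁅ a₁ ⁆ ∷ ⁅ a₂ ⁆ ∷ ⁅ a₃ ⁆ ∷ ⁅ b₁ ⁆ ∷ ⁅ b₂ ⁆ ∷ C ∷ []
    _# : ∀ {x y : Fin n} → x ≢ y → Disjoint ⁅ x ⁆ ⁅ y ⁆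
    x≢y # = ⁅x⁆-disjoint (x≢y⇒x∉⁅y⁆ x≢y)
    edge : ∀ (k l : Fin 3) → ∃ λ x → ∃ λ y → x ∈ lookup Bs (k ↑ˡ 3) × y ∈ lookup Bs (3 ↑ʳ l) × Adj G x y
    edge zero zero = _ , _ , x∈⁅x⁆ _ , x∈⁅x⁆ _ , a₁b₁
    edge zero (suc zero) = _ , _ , x∈⁅x⁆ _ , x∈⁅x⁆ _ , a₁b₂
    edge zero (suc (suc zero)) = _ , _ , x∈⁅x⁆ _ , c₁∈ , a₁c₁
    edge (suc zero) zero = _ , _ , x∈⁅x⁆ _ , x∈⁅x⁆ _ , a₂b₁
    edge (suc zero) (suc zero) = _ , _ , x∈⁅x⁆ _ , x∈⁅x⁆ _ , a₂b₂
    edge (suc zero) (suc (suc zero)) = _ , _ , x∈⁅x⁆ _ , c₂∈ , a₂c₂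
    edge (suc (suc zero)) zero = _ , _ , x∈⁅x⁆ _ , x∈⁅x⁆ _ , a₃b₁
    edge (suc (suc zero)) (suc zero) = _ , _ , x∈⁅x⁆ _ , x∈⁅x⁆ _ , a₃b₂
    edge (suc (suc zero)) (suc (suc zero)) = _ , _ , x∈⁅x⁆ _ , c₃∈ , a₃c₃

  K33-subgraph : ∀ {a₁ a₂ a₃ b₁ b₂ b₃ : Fin n} →
    a₁ ∈ p → a₂ ∈ p → a₃ ∈ p → b₁ ∈ p → b₂ ∈ p → b₃ ∈ p →
    a₁ ≢ a₂ → a₁ ≢ a₃ → a₂ ≢ a₃ → b₁ ≢ b₂ → b₁ ≢ b₃ → b₂ ≢ b₃ →
    Adj G a₁ b₁ × Adj G a₁ b₂ × Adj G a₁ b₃ → Adj G a₂ b₁ × Adj G a₂ b₂ × Adj G a₂ b₃ →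
    Adj G a₃ b₁ × Adj G a₃ b₂ × Adj G a₃ b₃ → K33-minor-in G p
  K33-subgraph {b₃ = b₃} a₁∈ a₂∈ a₃∈ b₁∈ b₂∈ b₃∈ a₁≢a₂ a₁≢a₃ a₂≢a₃ b₁≢b₂ b₁≢b₃ b₂≢b₃ a₁~ a₂~ a₃~ =
    K33-with-set a₁∈ a₂∈ a₃∈ b₁∈ b₂∈ (⁅x⁆-⊆ b₃∈) (ConnectedSet-⁅⁆ G b₃) a₁≢a₂ a₁≢a₃ a₂≢a₃ b₁≢b₂
      (x≢y⇒x∉⁅y⁆ b₁≢b₃) (x≢y⇒x∉⁅y⁆ b₂≢b₃) (sees a₁~) (sees a₂~) (sees a₃~)
    where
    sees : ∀ {a b₁ b₂} → Adj G a b₁ × Adj G a b₂ × Adj G a b₃ → SeesAll b₁ b₂ ⁅ b₃ ⁆ a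
    sees (ab₁ , ab₂ , ab₃) = ab₁ , ab₂ , x≢y⇒x∉⁅y⁆ (Adj⇒≢ G ab₃) , b₃ , x∈⁅x⁆ b₃ , ab₃

-- Finding a K₅ or a K₃,₃ minor

CliqueIn : Graph n → Subset n → ℕ → Set
CliqueIn G p m = ∃ λ K → K ⊆ p × Clique G K × ∣ K ∣ ≡ m

CliqueIn-⊥ : ∀ (G : Graph n) p → CliqueIn G p 0
CliqueIn-⊥ {n} G p = ⊥ , ⊥⊆ , (λ x∈ _ _ → contradiction x∈ ∉⊥) , ∣⊥∣≡0 n

CliqueIn-⊕ : ∀ {G : Graph n} {p m} ((K , _) : CliqueIn G p m) → x ∈ p → (∀ {y} → y ∈ K → Adj G x y) →
             CliqueIn G p (suc m)
CliqueIn-⊕ {x = x} {G} {p} (K , K⊆p , clique , ∣K∣≡m) x∈p x~K =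
  K ⊕ x , ⊕-elim (_∈ p) K K⊆p x∈p , clique′ ,
  trans (∣p⊕x∣≡1+∣p∣ λ x∈K → Adj⇒≢ G (x~K x∈K) refl) (cong suc ∣K∣≡m)
  where
  clique′ : Clique G (K ⊕ x)
  clique′ y∈ z∈ = ⊕-elim (λ y → ∀ {z} → z ∈ K ⊕ x → y ≢ z → Adj G y z) K
    (λ {y} y∈K → ⊕-elim (λ z → y ≢ z → Adj G y z) K (clique y∈K) (λ _ → Adj-sym G (x~K y∈K)))
    (⊕-elim (λ z → x ≢ z → Adj G x z) K (λ z∈K _ → x~K z∈K) (λ x≢x → contradiction refl x≢x))
    y∈ z∈

K4-in : ∀ (G : Graph n) {p x₁ x₂ x₃ x₄} → x₁ ∈ p → x₂ ∈ p → x₃ ∈ p → x₄ ∈ p →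
  Adj G x₁ x₂ → Adj G x₁ x₃ → Adj G x₁ x₄ → Adj G x₂ x₃ → Adj G x₂ x₄ → Adj G x₃ x₄ → CliqueIn G p 4
K4-in G {p} {x₁} {x₂} {x₃} {x₄} x₁∈ x₂∈ x₃∈ x₄∈ x₁x₂ x₁x₃ x₁x₄ x₂x₃ x₂x₄ x₃x₄ =
  CliqueIn-⊕ {G = G} (CliqueIn-⊕ {G = G} (CliqueIn-⊕ {G = G} (CliqueIn-⊕ {G = G} (CliqueIn-⊥ G p)
    x₄∈ λ y∈ → contradiction y∈ ∉⊥)
    x₃∈ (⊕-elim (Adj G x₃) ⊥ (λ y∈ → contradiction y∈ ∉⊥) x₃x₄))
    x₂∈ (⊕-elim (Adj G x₂) (⊥ ⊕ x₄) (⊕-elim (Adj G x₂) ⊥ (λ y∈ → contradiction y∈ ∉⊥) x₂x₄) x₂x₃))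
    x₁∈ (⊕-elim (Adj G x₁) (⊥ ⊕ x₄ ⊕ x₃)
          (⊕-elim (Adj G x₁) (⊥ ⊕ x₄) (⊕-elim (Adj G x₁) ⊥ (λ y∈ → contradiction y∈ ∉⊥) x₁x₄) x₁x₃) x₁x₂)

walk-end : ∀ {G : Graph n} {p} → x ∈ p → Connected G (_∈ p) x y → y ∈ p
walk-end x∈p here = x∈p
walk-end x∈p (step _ v∈p w) = walk-end v∈p w

pick₂ : ∀ {p : Subset n} {k} → 2 + k ≤ ∣ p ∣ → ∃ λ x → ∃ λ y → x ∈ p × y ∈ p × x ≢ y × k ≤ ∣ p - x - y ∣
pick₂ {p = p} k≤ with pick {p = p} k≤
... | x , x∈p , k≤′ with pick {p = p - x} k≤′
... | y , y∈ , k≤″ with x∈p-y⁻ p x y∈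
... | y∈p , y≢x = x , y , x∈p , y∈p , (λ x≡y → y≢x (sym x≡y)) , k≤″

pick₃ : ∀ {p : Subset n} {k} → 3 + k ≤ ∣ p ∣ → ∃ λ x → ∃ λ y → ∃ λ z →
        (x ∈ p × y ∈ p × z ∈ p) × (x ≢ y × x ≢ z × y ≢ z) × k ≤ ∣ p - x - y - z ∣
pick₃ {p = p} k≤ with pick₂ {p = p} k≤
... | x , y , x∈p , y∈p , x≢y , k≤′ with pick {p = p - x - y} k≤′
... | z , z∈ , k≤″ with x∈p-y⁻ (p - x) y z∈
... | z∈′ , z≢y with x∈p-y⁻ p x z∈′
... | z∈p , z≢x = x , y , z , (x∈p , y∈p , z∈p) , (x≢y , (λ x≡z → z≢x (sym x≡z)) , λ y≡z → z≢y (sym y≡z)) , k≤″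

-- v dominates H, and the adjacent vertices a and b are the only ones whose degree in H may be
-- less than 3.  If a and b have at most one common neighbour in the component D, then contracting
-- ab lowers the degree of at most one vertex, and that vertex is adjacent to the new one: the
-- situation reproduces itself on fewer vertices.
module Search (G : Graph n) {v : Fin n} {H : Subset n} (v~H : ∀ {w} → w ∈ H → Adj G v w)
  {a b c : Fin n} (a∈H : a ∈ H) (b∈H : b ∈ H) (ab : Adj G a b) (c∈H : c ∈ H) (bc : Adj G b c) (c≢a : c ≢ a)
  (deg : ∀ {w} → w ∈ H → w ≢ a → w ≢ b → 3 ≤ ∣ H ∩ N G w ∣) where

  p = H ⊕ v
  H⊆p : H ⊆ p
  H⊆p = p⊆p⊕x H v
  v∈p : v ∈ p
  v∈p = x∈p⊕x H v
  ≢v : ∀ {w} → w ∈ H → w ≢ v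
  ≢v w∈H w≡v = Adj⇒≢ G (v~H w∈H) (sym w≡v)

  c∈H-a-b : c ∈ H - a - b
  c∈H-a-b = x∈p∧x≢y⇒x∈p-y (x∈p∧x≢y⇒x∈p-y c∈H c≢a) (λ c≡b → Adj⇒≢ G bc (sym c≡b))

  open Component (component G c∈H-a-b) public using (closed) renaming
    (set to D; ⊆p to D⊆H-a-b; root to c∈D; connected to D-connected)

  D⊆ : ∀ {w} → w ∈ D → w ∈ H × w ≢ a × w ≢ b
  D⊆ w∈D with x∈p-y⁻ (H - a) b (D⊆H-a-b w∈D)
  ... | w∈H-a , w≢b with x∈p-y⁻ H a w∈H-a
  ... | w∈H , w≢a = w∈H , w≢a , w≢b

  D⊆H : D ⊆ H
  D⊆H w∈D = proj₁ (D⊆ w∈D)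

  neighbour : ∀ {w y} → w ∈ D → y ∈ H → y ≢ a → y ≢ b → Adj G w y → y ∈ D
  neighbour w∈D y∈H y≢a y≢b = closed w∈D (x∈p∧x≢y⇒x∈p-y (x∈p∧x≢y⇒x∈p-y y∈H y≢a) y≢b)

  W : Subset n
  W = (D ∩ N G a) ∩ N G b

  W⁻ : ∀ {w} → w ∈ W → w ∈ D × Adj G a w × Adj G b w
  W⁻ w∈W with ∈-p∩N⁻ G (D ∩ N G a) w∈W
  ... | w∈∩ , bw with ∈-p∩N⁻ G D w∈∩
  ... | w∈D , aw = w∈D , aw , bw

  -- `a` and `b` with three common neighbours are a K₂,₃, and `v` is the third vertex on the side of
  -- `a` and `b`.
  large-W : 3 ≤ ∣ W ∣ → K33-minor-in G p
  large-W 3≤ with pick₃ {p = W} 3≤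
  ... | x , y , z , (x∈ , y∈ , z∈) , (x≢y , x≢z , y≢z) , _ =
    let x∈D , ax , bx = W⁻ x∈
        y∈D , ay , by = W⁻ y∈
        z∈D , az , bz = W⁻ z∈
    in K33-subgraph G (H⊆p a∈H) (H⊆p b∈H) v∈p (H⊆p (D⊆H x∈D)) (H⊆p (D⊆H y∈D)) (H⊆p (D⊆H z∈D))
      (Adj⇒≢ G ab) (≢v a∈H) (≢v b∈H) x≢y x≢z y≢z
      (ax , ay , az) (bx , by , bz) (v~H (D⊆H x∈D) , v~H (D⊆H y∈D) , v~H (D⊆H z∈D))

  -- The sides of the K₃,₃ are {x , y , v} and {a , b , I}, with I the interior of a path from x to y.
  non-adjacent : ∀ {x y} → x ∈ W → y ∈ W → x ≢ y → ¬ Adj G x y → K33-minor-in G p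
  non-adjacent {x} {y} x∈ y∈ x≢y x≁y with W⁻ x∈ | W⁻ y∈
  ... | x∈D , ax , bx | y∈D , ay , by
    with z , zy , x⇝z ← walk-before (D-connected x∈D y∈D) x≢y
    with x∈D-y ← x∈p∧x≢y⇒x∈p-y x∈D x≢y
    -- Non-adjacency makes the interior non-empty: it contains `z`. Cutting the reversed walk at `x`
    -- yields `u`, the neighbour of `x` on it, so `z` and `u` lie in one component of `D - y - x`.
    with z≢x ← (λ (z≡x : z ≡ x) → x≁y (subst (λ u → Adj G u y) z≡x zy))
    with u , ux , z⇝u ← walk-before (walk-reverse x∈D-y x⇝z) z≢x =
    K33-with-set G (H⊆p (D⊆H x∈D)) (H⊆p (D⊆H y∈D)) v∈p (H⊆p a∈H) (H⊆p b∈H) (λ w∈I → H⊆p (D⊆H (I⊆D w∈I)))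
      (Component.connected comp) x≢y (≢v (D⊆H x∈D)) (≢v (D⊆H y∈D)) (Adj⇒≢ G ab)
      (λ a∈I → proj₁ (proj₂ (D⊆ (I⊆D a∈I))) refl) (λ b∈I → proj₂ (proj₂ (D⊆ (I⊆D b∈I))) refl)
      (Adj-sym G ax , Adj-sym G bx , (λ x∈I → proj₂ (x∈p-y⁻ (D - y) x (I⊆ x∈I)) refl) ,
        u , Component.closed-walk comp (Component.root comp) z⇝u , Adj-sym G ux)
      (Adj-sym G ay , Adj-sym G by , (λ y∈I → proj₂ (x∈p-y⁻ D y (I⊆D-y y∈I)) refl) ,
        z , Component.root comp , Adj-sym G zy)
      (v~H a∈H , v~H b∈H , (λ v∈I → ≢v (D⊆H (I⊆D v∈I)) refl) ,
        z , Component.root comp , v~H (D⊆H (I⊆D (Component.root comp))))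
    where
    comp = component G {D - y - x} (x∈p∧x≢y⇒x∈p-y (walk-end x∈D-y x⇝z) z≢x)
    I = Component.set comp
    I⊆ : I ⊆ D - y - x
    I⊆ = Component.⊆p comp
    I⊆D-y : I ⊆ D - y
    I⊆D-y w∈I = proj₁ (x∈p-y⁻ (D - y) x (I⊆ w∈I))
    I⊆D : I ⊆ D
    I⊆D w∈I = proj₁ (x∈p-y⁻ D y (I⊆D-y w∈I))

  two-in-W : 2 ≤ ∣ W ∣ → CliqueIn G H 4 ⊎ K33-minor-in G p
  two-in-W 2≤ with pick₂ {p = W} 2≤
  ... | x , y , x∈ , y∈ , x≢y , _ with adj G x y Bool.≟ true | W⁻ x∈ | W⁻ y∈
  ... | no x≁y | _ | _ = inj₂ (non-adjacent x∈ y∈ x≢y x≁y)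
  ... | yes xy | x∈D , ax , bx | y∈D , ay , by =
    inj₁ (K4-in G a∈H b∈H (D⊆H x∈D) (D⊆H y∈D) ab ax ay bx by xy)

  -- The next round: `a` now stands for the edge `ab`, and of the remaining vertices only `D` is
  -- kept. Dropping the other components costs the vertices of `D` no degree, since their neighbours
  -- in `H` lie in `D`, `a` and `b`.
  G′ = contract G a b
  H′ = D ⊕ a

  H′⊆H : H′ ⊆ H
  H′⊆H = ⊕-elim (_∈ H) D D⊆H a∈H

  H′≢b : ∀ {w} → w ∈ H′ → w ≢ b
  H′≢b = ⊕-elim (_≢ b) D (λ w∈D → proj₂ (proj₂ (D⊆ w∈D))) (Adj⇒≢ G ab)

  -- A neighbour `b` of `w` is replaced by `a`. This costs a degree only if `a` was a neighbour
  -- already, that is, if `w ∈ W`.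
  deg′ : ∀ {w} → w ∈ D → w ∉ W → 3 ≤ ∣ H′ ∩ N G′ w ∣
  deg′ {w} w∈D w∉W with D⊆ w∈D
  ... | w∈H , w≢a , w≢b with adj G w b Bool.≟ true
  ... | no w≁b = ≤-trans (deg w∈H w≢a w≢b) (p⊆q⇒∣p∣≤∣q∣ {p = H ∩ N G w} ⊆′)
    where
    ⊆′ : H ∩ N G w ⊆ H′ ∩ N G′ w
    ⊆′ {y} y∈ with ∈-p∩N⁻ G H y∈ | y ≟ a
    ... | y∈H , wy | yes refl = ∈-p∩N⁺ G′ (x∈p⊕x D a) (contract-⊇ G wy)
    ... | y∈H , wy | no y≢a = ∈-p∩N⁺ G′
      (p⊆p⊕x D a (neighbour w∈D y∈H y≢a (λ { refl → w≁b wy }) wy)) (contract-⊇ G wy)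
  ... | yes wb = begin
    3                          ≤⟨ deg w∈H w≢a w≢b ⟩
    ∣ H ∩ N G w ∣               ≡⟨ ∣p∣≡1+∣p-x∣ (∈-p∩N⁺ G b∈H wb) ⟩
    suc ∣ H ∩ N G w - b ∣       ≤⟨ s≤s (p⊆q⇒∣p∣≤∣q∣ {p = H ∩ N G w - b} ⊆′) ⟩
    suc ∣ H′ ∩ N G′ w - a ∣     ≡⟨ ∣p∣≡1+∣p-x∣ (∈-p∩N⁺ G′ (x∈p⊕x D a) wa′) ⟨
    ∣ H′ ∩ N G′ w ∣             ∎
    where
    open ≤-Reasoning
    wa′ : Adj G′ w a
    wa′ = Adj-sym G′ (contract-merged G (Adj-sym G wb) w≢a)
    ⊆′ : H ∩ N G w - b ⊆ H′ ∩ N G′ w - a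
    ⊆′ {y} y∈ with x∈p-y⁻ (H ∩ N G w) b y∈
    ... | y∈∩ , y≢b with ∈-p∩N⁻ G H y∈∩ | y ≟ a
    ... | y∈H , wy | yes refl = contradiction (∈-p∩N⁺ G (∈-p∩N⁺ G w∈D (Adj-sym G wy)) (Adj-sym G wb)) w∉W
    ... | y∈H , wy | no y≢a = x∈p∧x≢y⇒x∈p-y
      (∈-p∩N⁺ G′ (p⊆p⊕x D a (neighbour w∈D y∈H y≢a y≢b wy)) (contract-⊇ G wy)) y≢a

  -- Chooses the partner of the merged vertex in the next exceptional pair: the one vertex that lost
  -- a degree, if it exists. Otherwise `c` serves, being a neighbour of `b` and so of the merged
  -- vertex.
  next : ∣ W ∣ ≤ 1 → ∃ λ e → e ∈ D × Adj G′ a e × (∀ {w} → w ≢ e → w ∉ W)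
  next ∣W∣≤1 with nonempty? W
  ... | no empty = c , c∈D , contract-merged G bc c≢a , λ _ w∈W → empty (_ , w∈W)
  ... | yes (e , e∈W) with W⁻ e∈W
  ... | e∈D , ae , be = e , e∈D , contract-⊇ G ae , λ w≢e w∈W →
    ∣p∣≡0⇒x∉p {p = W - e} (s≤s⁻¹ (≤-trans (≤-reflexive (sym (∣p∣≡1+∣p-x∣ e∈W))) ∣W∣≤1)) (x∈p∧x≢y⇒x∈p-y w∈W w≢e)

  -- Of three neighbours of `e` in `H` at most two are `a` and `b`. The third becomes the `c` of the
  -- next round.
  neighbour-in-D : ∀ {e} → e ∈ D → ∃ λ e′ → e′ ∈ D × Adj G e e′
  neighbour-in-D {e} e∈D with D⊆ e∈D
  ... | e∈H , e≢a , e≢b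
    with e′ , e′∈ , _ ← pick {p = H ∩ N G e - a - b} {0} (s≤s⁻¹ (s≤s⁻¹ (≤-trans (deg e∈H e≢a e≢b)
      (≤-trans (∣p∣≤1+∣p-x∣ (H ∩ N G e) a) (s≤s (∣p∣≤1+∣p-x∣ (H ∩ N G e - a) b))))))
    with e′∈′ , e′≢b ← x∈p-y⁻ (H ∩ N G e - a) b e′∈
    with e′∈″ , e′≢a ← x∈p-y⁻ (H ∩ N G e) a e′∈′
    with e′∈H , ee′ ← ∈-p∩N⁻ G H e′∈″ = e′ , neighbour e∈D e′∈H e′≢a e′≢b ee′ , ee′

  lift-K33 : K33-minor-in G′ (H′ ⊕ v) → K33-minor-in G p
  lift-K33 m = K33-contract G (H⊆p a∈H) (H⊆p b∈H) ab (K33-⊆ ⊆p-b m)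
    where
    ⊆p-b : H′ ⊕ v ⊆ p - b
    ⊆p-b = ⊕-elim (_∈ p - b) H′ (λ w∈ → x∈p∧x≢y⇒x∈p-y (H⊆p (H′⊆H w∈)) (H′≢b w∈))
      (x∈p∧x≢y⇒x∈p-y v∈p λ v≡b → ≢v b∈H (sym v≡b))

  -- The pattern of a K₄ whose merged vertex splits into `s` and `t`, with `y` and `z` attached to
  -- `s` and `x` attached to `t`. The sides of the K₃,₃ are `s`, `x`, `v` and `t`, `y`, `z`.
  crossing : ∀ {s t x y z} → s ∈ H → t ∈ H → x ∈ H → y ∈ H → z ∈ H → s ≢ x → t ≢ y → t ≢ z →
    Adj G s t → Adj G t x → Adj G s y → Adj G s z → Adj G x y → Adj G x z → Adj G y z → K33-minor-in G p
  crossing s∈ t∈ x∈ y∈ z∈ s≢x t≢y t≢z st tx sy sz xy xz yz =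
    K33-subgraph G (H⊆p s∈) (H⊆p x∈) v∈p (H⊆p t∈) (H⊆p y∈) (H⊆p z∈)
      s≢x (≢v s∈) (≢v x∈) t≢y t≢z (Adj⇒≢ G yz)
      (st , sy , sz) (Adj-sym G tx , xy , xz) (v~H t∈ , v~H y∈ , v~H z∈)

  -- A K₄ avoiding `a` is untouched by the contraction. Otherwise each of its other three vertices
  -- is joined to `a` or to `b` in `G`: all three to the same end gives a K₄, and each of the six
  -- two-to-one distributions is a `crossing`.
  lift-K4 : CliqueIn G′ H′ 4 → CliqueIn G H 4 ⊎ K33-minor-in G p
  lift-K4 (K , K⊆H′ , clique , ∣K∣≡4) with a ∈? K
  ... | no a∉K = inj₁ (K , (λ x∈ → H′⊆H (K⊆H′ x∈)) , clique′ , ∣K∣≡4)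
    where
    clique′ : Clique G K
    clique′ x∈ y∈ x≢y =
      contract-⊆′ G (λ { refl → a∉K x∈ }) (λ { refl → a∉K y∈ }) (clique x∈ y∈ x≢y)
  ... | yes a∈K
    with x , y , z , (x∈ , y∈ , z∈) , (x≢y , x≢z , y≢z) , _ ←
      pick₃ {p = K - a} (s≤s⁻¹ (≤-reflexive (trans (sym ∣K∣≡4) (∣p∣≡1+∣p-x∣ a∈K)))) =
    cases (joins x∈) (joins y∈) (joins z∈)
    where
    K-a⁻ : ∀ {w} → w ∈ K - a → w ∈ H × a ≢ w × b ≢ w × w ∈ K
    K-a⁻ w∈ with x∈p-y⁻ K a w∈
    ... | w∈K , w≢a = H′⊆H (K⊆H′ w∈K) , (λ a≡w → w≢a (sym a≡w)) , (λ b≡w → H′≢b (K⊆H′ w∈K) (sym b≡w)) , w∈K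
    ∈H : ∀ {w} → w ∈ K - a → w ∈ H
    ∈H w∈ = proj₁ (K-a⁻ w∈)
    a≢ : ∀ {w} → w ∈ K - a → a ≢ w
    a≢ w∈ = proj₁ (proj₂ (K-a⁻ w∈))
    b≢ : ∀ {w} → w ∈ K - a → b ≢ w
    b≢ w∈ = proj₁ (proj₂ (proj₂ (K-a⁻ w∈)))
    joins : ∀ {w} → w ∈ K - a → Adj G a w ⊎ Adj G b w
    joins w∈ with K-a⁻ w∈
    ... | _ , a≢w , _ , w∈K with contract-⊆ G (clique a∈K w∈K a≢w)
    ... | inj₁ aw = inj₁ aw
    ... | inj₂ (inj₁ (_ , bw)) = inj₂ bw
    ... | inj₂ (inj₂ (w≡a , _)) = contradiction (sym w≡a) a≢w
    join : ∀ {w w′} → w ∈ K - a → w′ ∈ K - a → w ≢ w′ → Adj G w w′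
    join w∈ w′∈ w≢w′ with K-a⁻ w∈ | K-a⁻ w′∈
    ... | _ , a≢w , _ , w∈K | _ , a≢w′ , _ , w′∈K =
      contract-⊆′ G (λ w≡a → a≢w (sym w≡a)) (λ w′≡a → a≢w′ (sym w′≡a)) (clique w∈K w′∈K w≢w′)
    xy = join x∈ y∈ x≢y
    xz = join x∈ z∈ x≢z
    yz = join y∈ z∈ y≢z
    yx = Adj-sym G xy
    zx = Adj-sym G xz
    zy = Adj-sym G yz
    ba = Adj-sym G ab
    cases : Adj G a x ⊎ Adj G b x → Adj G a y ⊎ Adj G b y → Adj G a z ⊎ Adj G b z →
            CliqueIn G H 4 ⊎ K33-minor-in G p
    cases (inj₁ ax) (inj₁ ay) (inj₁ az) = inj₁ (K4-in G a∈H (∈H x∈) (∈H y∈) (∈H z∈) ax ay az xy xz yz)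
    cases (inj₂ bx) (inj₂ by) (inj₂ bz) = inj₁ (K4-in G b∈H (∈H x∈) (∈H y∈) (∈H z∈) bx by bz xy xz yz)
    cases (inj₂ bx) (inj₁ ay) (inj₁ az) = inj₂
      (crossing a∈H b∈H (∈H x∈) (∈H y∈) (∈H z∈) (a≢ x∈) (b≢ y∈) (b≢ z∈) ab bx ay az xy xz yz)
    cases (inj₁ ax) (inj₂ by) (inj₁ az) = inj₂
      (crossing a∈H b∈H (∈H y∈) (∈H x∈) (∈H z∈) (a≢ y∈) (b≢ x∈) (b≢ z∈) ab by ax az yx yz xz)
    cases (inj₁ ax) (inj₁ ay) (inj₂ bz) = inj₂
      (crossing a∈H b∈H (∈H z∈) (∈H x∈) (∈H y∈) (a≢ z∈) (b≢ x∈) (b≢ y∈) ab bz ax ay zx zy xy)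
    cases (inj₁ ax) (inj₂ by) (inj₂ bz) = inj₂
      (crossing b∈H a∈H (∈H x∈) (∈H y∈) (∈H z∈) (b≢ x∈) (a≢ y∈) (a≢ z∈) ba ax by bz xy xz yz)
    cases (inj₂ bx) (inj₁ ay) (inj₂ bz) = inj₂
      (crossing b∈H a∈H (∈H y∈) (∈H x∈) (∈H z∈) (b≢ y∈) (a≢ x∈) (a≢ z∈) ba ay bx bz yx yz xz)
    cases (inj₂ bx) (inj₂ by) (inj₁ az) = inj₂
      (crossing b∈H a∈H (∈H z∈) (∈H x∈) (∈H y∈) (b≢ z∈) (a≢ x∈) (a≢ y∈) ba az bx by zx zy xy)

-- `H′` omits `b`, so the bound `k` on the size falls. Since `a ∈ H` the set never becomes empty, so
-- some round must meet two common neighbours in `W`.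
K4-or-K33 : ∀ k (G : Graph n) {v H a b c} → ∣ H ∣ ≤ k → (∀ {w} → w ∈ H → Adj G v w) →
  a ∈ H → b ∈ H → Adj G a b → c ∈ H → Adj G b c → c ≢ a →
  (∀ {w} → w ∈ H → w ≢ a → w ≢ b → 3 ≤ ∣ H ∩ N G w ∣) →
  CliqueIn G H 4 ⊎ K33-minor-in G (H ⊕ v)
K4-or-K33 zero G ∣H∣≤k v~H a∈H _ _ _ _ _ _ = contradiction a∈H (∣p∣≡0⇒x∉p ∣H∣≤k)
K4-or-K33 (suc k) G {v} {H} {a} {b} ∣H∣≤k v~H a∈H b∈H ab c∈H bc c≢a deg with 3 ≤? ∣ Search.W G {v} {H} v~H a∈H b∈H ab c∈H bc c≢a deg ∣
... | yes 3≤W = inj₂ (Search.large-W G v~H a∈H b∈H ab c∈H bc c≢a deg 3≤W)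
... | no _ with 2 ≤? ∣ Search.W G {v} {H} v~H a∈H b∈H ab c∈H bc c≢a deg ∣
... | yes 2≤W = Search.two-in-W G v~H a∈H b∈H ab c∈H bc c≢a deg 2≤W
... | no ¬2≤W with Search.next G {v} {H} v~H a∈H b∈H ab c∈H bc c≢a deg (s≤s⁻¹ (≰⇒> ¬2≤W))
... | e , e∈D , ae , e-only with Search.neighbour-in-D G {v} {H} v~H a∈H b∈H ab c∈H bc c≢a deg e∈D
... | e′ , e′∈D , ee′ =
  Sum.[ lift-K4 , (λ m → inj₂ (lift-K33 m)) ]
    -- The merged vertex keeps the name `a` and goes on absorbing neighbours: next comes `e`, with
    -- `e′` in the role of `c`.
    (K4-or-K33 k G′ {v} {H′} {a} {e} {e′} size (λ w∈ → contract-⊇ G (v~H (H′⊆H w∈)))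
      (x∈p⊕x D a) (p⊆p⊕x D a e∈D) ae (p⊆p⊕x D a e′∈D) (contract-⊇ G ee′) (proj₁ (proj₂ (D⊆ e′∈D)))
      λ w∈ w≢a w≢e → deg′ (⊕-elim (λ w → w ≢ a → w ∈ D) D (λ w∈D _ → w∈D) (λ a≢a → contradiction refl a≢a) w∈ w≢a) (e-only w≢e))
  where
  open Search G {v} {H} v~H a∈H b∈H ab c∈H bc c≢a deg
  size : ∣ H′ ∣ ≤ k
  size = s≤s⁻¹ (≤-trans (s≤s (p⊆q⇒∣p∣≤∣q∣ {p = H′} {q = H - b} (λ w∈ → x∈p∧x≢y⇒x∈p-y (H′⊆H w∈) (H′≢b w∈))))
    (≤-trans (≤-reflexive (sym (∣p∣≡1+∣p-x∣ b∈H))) ∣H∣≤k))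

∣p─q∣+∣q∣≡∣p∣ : ∀ (p q : Subset n) → q ⊆ p → ∣ p ─ q ∣ + ∣ q ∣ ≡ ∣ p ∣
∣p─q∣+∣q∣≡∣p∣ [] [] q⊆p = refl
∣p─q∣+∣q∣≡∣p∣ (outside ∷ p) (inside ∷ q) q⊆p with () ← q⊆p here
∣p─q∣+∣q∣≡∣p∣ (outside ∷ p) (outside ∷ q) q⊆p = ∣p─q∣+∣q∣≡∣p∣ p q (drop-∷-⊆ q⊆p)
∣p─q∣+∣q∣≡∣p∣ (inside ∷ p) (outside ∷ q) q⊆p = cong suc (∣p─q∣+∣q∣≡∣p∣ p q (drop-∷-⊆ q⊆p))
∣p─q∣+∣q∣≡∣p∣ (inside ∷ p) (inside ∷ q) q⊆p =
  trans (+-suc ∣ p ─ q ∣ ∣ q ∣) (cong suc (∣p─q∣+∣q∣≡∣p∣ p q (drop-∷-⊆ q⊆p)))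

-- Falls back on any element of `p` when `q` is empty: the edge to cut along needs two ends even if
-- the component touches fewer than two vertices of the K₅.
choose : ∀ {p q : Subset n} {m} → q ⊆ p → 1 ≤ ∣ p ∣ → ∣ q ∣ ≤ suc m → ∃ λ x → x ∈ p × ∣ q - x ∣ ≤ m
choose {n} {p} {q} q⊆p 1≤p q≤ with nonempty? q
... | yes (x , x∈q) = x , q⊆p x∈q , s≤s⁻¹ (≤-trans (≤-reflexive (sym (∣p∣≡1+∣p-x∣ x∈q))) q≤)
... | no empty with pick {p = p} 1≤p
... | x , x∈p , _ = x , x∈p , ≤-trans (p⊆q⇒∣p∣≤∣q∣ {p = q - x} {q = q} (p─q⊆p q ⁅ x ⁆))
        (≤-trans (≤-reflexive (trans (cong ∣_∣ (Empty-unique empty)) (∣⊥∣≡0 n))) z≤n)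

1≤cliques : ∀ (G : Graph n) p → 1 ≤ cliques G p
1≤cliques G [] = ≤-refl
1≤cliques G (outside ∷ p) = 1≤cliques (tail G) p
1≤cliques G (inside ∷ p) = ≤-trans (1≤cliques (tail G) p) (m≤m+n _ _)

2≤cliques : ∀ (G : Graph n) {p} → x ∈ p → 2 ≤ cliques G p
2≤cliques {x = x} G {p} x∈p =
  ≤-trans (+-mono-≤ (1≤cliques G (p - x)) (1≤cliques G (p ∩ N G x))) (≤-reflexive (sym (cliques-peel G x∈p)))

4≤cliques : ∀ (G : Graph n) {p} → x ∈ p → y ∈ p → Adj G x y → 4 ≤ cliques G p
4≤cliques G x∈p y∈p xy = ≤-trans
  (+-mono-≤ (2≤cliques G (x∈p∧x≢y⇒x∈p-y y∈p (λ y≡x → Adj⇒≢ G xy (sym y≡x)))) (2≤cliques G (∈-p∩N⁺ G y∈p xy)))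
  (≤-reflexive (sym (cliques-peel G x∈p)))

-- The upper bound

-- The bound `4(7n − 11)/3`, cleared of division and of truncated subtraction.
Bound : Graph n → Subset n → Set
Bound G p = 3 * cliques G p + 44 ≤ 28 * ∣ p ∣

module AroundK5 (G : Graph n) {p K : Subset n} (K⊆p : K ⊆ p) (clique : Clique G K) (∣K∣≡5 : ∣ K ∣ ≡ 5)
  {w : Fin n} (w∈p─K : w ∈ p ─ K) where

  open Component (component G w∈p─K) public renaming (set to D)

  D⊆p : D ⊆ p
  D⊆p x∈D = p─q⊆p p K (⊆p x∈D)

  K∩D : ∀ {x} → x ∈ K → x ∉ D
  K∩D x∈K x∈D = proj₂ (x∈p─q⁻ p K (⊆p x∈D)) x∈K

  touches? : ∀ x → Dec (∃ λ d → d ∈ D × Adj G x d)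
  touches? x = any? λ d → (d ∈? D) ×-dec (adj G x d Bool.≟ true)

  -- The attachments of the component `D` on the K₅.
  Q : Subset n
  Q = K ∩ tabulate (λ x → isYes (touches? x))

  Q⁺ : ∀ {x d} → x ∈ K → d ∈ D → Adj G x d → x ∈ Q
  Q⁺ {x} {d} x∈K d∈D xd = x∈p∩q⁺ (x∈K , ∈-tabulate⁺ isYes-touches)
    where
    isYes-touches : isYes (touches? x) ≡ true
    isYes-touches with touches? x
    ... | yes _ = refl
    ... | no ¬t = contradiction (d , d∈D , xd) ¬t

  Q⁻ : ∀ {x} → x ∈ Q → x ∈ K × ∃ λ d → d ∈ D × Adj G x d
  Q⁻ {x} x∈Q with x∈p∩q⁻ K _ x∈Q
  ... | x∈K , x∈t = x∈K , from-isYes (∈-tabulate⁻ {f = λ x → isYes (touches? x)} x∈t)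
    where
    from-isYes : isYes (touches? x) ≡ true → ∃ λ d → d ∈ D × Adj G x d
    from-isYes eq with touches? x
    ... | yes t = t

  private
    K---⁻ : ∀ x y z {w} → w ∈ K - x - y - z → w ∈ K × w ≢ x × w ≢ y × w ≢ z
    K---⁻ x y z w∈ = let w∈₁ , w≢z = x∈p-y⁻ (K - x - y) z w∈
                         w∈₂ , w≢y = x∈p-y⁻ (K - x) y w∈₁
                         w∈K , w≢x = x∈p-y⁻ K x w∈₂
                     in w∈K , w≢x , w≢y , w≢z

  -- Three attachments form one side; the two remaining vertices of the K₅ and the connected set `D`
  -- form the other.
  many-touching : 3 ≤ ∣ Q ∣ → K33-minor-in G p
  many-touching 3≤Q with pick₃ {p = Q} 3≤Q
  ... | x , y , z , (x∈Q , y∈Q , z∈Q) , (x≢y , x≢z , y≢z) , _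
    with pick₂ {p = K - x - y - z} {0} (s≤s⁻¹ (s≤s⁻¹ (s≤s⁻¹
      (≤-trans (≤-reflexive (sym ∣K∣≡5)) (≤-trans (∣p∣≤1+∣p-x∣ K x)
        (s≤s (≤-trans (∣p∣≤1+∣p-x∣ (K - x) y) (s≤s (∣p∣≤1+∣p-x∣ (K - x - y) z)))))))))
  ... | s , t , s∈ , t∈ , s≢t , _ =
    let x∈K , x-touches = Q⁻ x∈Q
        y∈K , y-touches = Q⁻ y∈Q
        z∈K , z-touches = Q⁻ z∈Q
        s∈K , s≢x , s≢y , s≢z = K---⁻ x y z s∈
        t∈K , t≢x , t≢y , t≢z = K---⁻ x y z t∈
    in K33-with-set G (K⊆p x∈K) (K⊆p y∈K) (K⊆p z∈K) (K⊆p s∈K) (K⊆p t∈K) D⊆p connected x≢y x≢z y≢z s≢t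
      (K∩D s∈K) (K∩D t∈K)
      (clique x∈K s∈K (s≢x ∘ sym) , clique x∈K t∈K (t≢x ∘ sym) , K∩D x∈K , x-touches)
      (clique y∈K s∈K (s≢y ∘ sym) , clique y∈K t∈K (t≢y ∘ sym) , K∩D y∈K , y-touches)
      (clique z∈K s∈K (s≢z ∘ sym) , clique z∈K t∈K (t≢z ∘ sym) , K∩D z∈K , z-touches)

  cover-Q : ∣ Q ∣ ≤ 2 → ∃ λ x → ∃ λ y → x ∈ K × y ∈ K × y ≢ x × ∣ Q - x - y ∣ ≤ 0
  cover-Q Q≤2
    with choose {p = K} {q = Q} (p∩q⊆p K _) (≤-trans (s≤s z≤n) (≤-reflexive (sym ∣K∣≡5))) Q≤2
  ... | x , x∈K , Q-x≤1
    with choose {p = K - x} {q = Q - x}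
      (λ z∈ → let z∈Q , z≢x = x∈p-y⁻ Q x z∈ in x∈p∧x≢y⇒x∈p-y (p∩q⊆p K _ z∈Q) z≢x)
      (s≤s⁻¹ (≤-trans (s≤s (s≤s z≤n)) (≤-trans (≤-reflexive (sym ∣K∣≡5)) (∣p∣≤1+∣p-x∣ K x)))) Q-x≤1
  ... | y , y∈K-x , Q-x-y≤0 with x∈p-y⁻ K x y∈K-x
  ... | y∈K , y≢x = x , y , x∈K , y∈K , y≢x , Q-x-y≤0

  -- `A` and `B` overlap in the ends of the edge `xy`, which contains all attachments of `D`. At
  -- least four cliques, those on `xy`, are counted in both parts.
  split : ∣ Q ∣ ≤ 2 → (∀ q → q ⊆ p → ∣ q ∣ < ∣ p ∣ → 3 ≤ ∣ q ∣ → Bound G q) → Bound G p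
  split Q≤2 bound-sub with cover-Q Q≤2
  ... | x , y , x∈K , y∈K , y≢x , Q-x-y≤0 =
    arith (cliques G p) (cliques G A) (cliques G B) (∣ D ∣) (∣ B ∣) (∣ p ∣) counts
      (subst (λ s → 3 * cliques G A + 44 ≤ 28 * s) ∣A∣ (bound-sub A A⊆p A<p 3≤A))
      (bound-sub B (p─q⊆p p D) B<p (≤-trans (s≤s (s≤s (s≤s z≤n))) 5≤B)) ∣B∣+∣D∣
    where
    A = D ⊕ x ⊕ y
    B = p ─ D

    arith : ∀ c cA cB d b s → c + 4 ≤ cA + cB → 3 * cA + 44 ≤ 28 * (2 + d) → 3 * cB + 44 ≤ 28 * b → b + d ≡ s →
            3 * c + 44 ≤ 28 * s
    -- 56 is both `3 · 4 + 44`, for the four shared cliques and the second constant 44, and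
    -- `28 · 2`, for the two shared vertices. This is why nothing is lost.
    arith c cA cB d b .(b + d) h hA hB refl = +-cancelʳ-≤ 56 (3 * c + 44) (28 * (b + d)) (begin
      (3 * c + 44) + 56            ≡⟨ eq₁ c ⟩
      3 * (c + 4) + 88             ≤⟨ +-monoˡ-≤ 88 (*-monoʳ-≤ 3 h) ⟩
      3 * (cA + cB) + 88           ≡⟨ eq₂ cA cB ⟩
      (3 * cA + 44) + (3 * cB + 44) ≤⟨ +-mono-≤ hA hB ⟩
      28 * (2 + d) + 28 * b         ≡⟨ eq₃ d b ⟩
      28 * (b + d) + 56             ∎)
      where
      open ≤-Reasoning
      eq₁ : ∀ c → (3 * c + 44) + 56 ≡ 3 * (c + 4) + 88
      eq₁ = solve-∀
      eq₂ : ∀ a b → 3 * (a + b) + 88 ≡ (3 * a + 44) + (3 * b + 44)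
      eq₂ = solve-∀
      eq₃ : ∀ d b → 28 * (2 + d) + 28 * b ≡ 28 * (b + d) + 56
      eq₃ = solve-∀

    Q⊆xy : ∀ {z} → z ∈ Q → z ∈ A
    Q⊆xy {z} z∈Q with z ≟ x | z ≟ y
    ... | yes refl | _ = p⊆p⊕x (D ⊕ x) y (x∈p⊕x D x)
    ... | no _ | yes refl = x∈p⊕x (D ⊕ x) y
    ... | no z≢x | no z≢y =
      contradiction (x∈p∧x≢y⇒x∈p-y (x∈p∧x≢y⇒x∈p-y z∈Q z≢x) z≢y) (∣p∣≡0⇒x∉p {p = Q - x - y} Q-x-y≤0)

    K⊆B : K ⊆ B
    K⊆B z∈K = x∈p∧x∉q⇒x∈p─q (K⊆p z∈K) (K∩D z∈K)

    separated : ∀ {s t} → s ∈ A → t ∈ B → Adj G s t → s ∈ B ⊎ t ∈ A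
    separated {t = t} s∈A t∈B = ⊕-elim (λ s → Adj G s t → s ∈ B ⊎ t ∈ A) (D ⊕ x)
      (⊕-elim (λ s → Adj G s t → s ∈ B ⊎ t ∈ A) D from-D (λ _ → inj₁ (K⊆B x∈K))) (λ _ → inj₁ (K⊆B y∈K)) s∈A
      where
      from-D : ∀ {s} → s ∈ D → Adj G s t → s ∈ B ⊎ t ∈ A
      from-D s∈D st with x∈p─q⁻ p D t∈B | t ∈? K
      ... | _ | yes t∈K = inj₂ (Q⊆xy (Q⁺ t∈K s∈D (Adj-sym G st)))
      ... | t∈p , t∉D | no t∉K = contradiction (closed s∈D (x∈p∧x∉q⇒x∈p─q t∈p t∉K) st) t∉D

    p⊆A∪B : p ⊆ A ∪ B
    p⊆A∪B {z} z∈p with z ∈? D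
    ... | yes z∈D = x∈p∪q⁺ (inj₁ (p⊆p⊕x (D ⊕ x) y (p⊆p⊕x D x z∈D)))
    ... | no z∉D = x∈p∪q⁺ (inj₂ (x∈p∧x∉q⇒x∈p─q z∈p z∉D))

    counts : cliques G p + 4 ≤ cliques G A + cliques G B
    counts = ≤-trans
      (+-mono-≤ (cliques-⊆ G p⊆A∪B)
        (4≤cliques G (x∈p∩q⁺ (p⊆p⊕x (D ⊕ x) y (x∈p⊕x D x) , K⊆B x∈K))
          (x∈p∩q⁺ (x∈p⊕x (D ⊕ x) y , K⊆B y∈K)) (clique x∈K y∈K (y≢x ∘ sym))))
      (cliques-separation G A B separated)

    A⊆p : A ⊆ p
    A⊆p = ⊕-elim (_∈ p) (D ⊕ x) (⊕-elim (_∈ p) D D⊆p (K⊆p x∈K)) (K⊆p y∈K)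

    ∣A∣ : ∣ A ∣ ≡ 2 + ∣ D ∣
    ∣A∣ = trans (∣p⊕x∣≡1+∣p∣ y∉D⊕x) (cong suc (∣p⊕x∣≡1+∣p∣ (K∩D x∈K)))
      where
      y∉D⊕x : y ∉ D ⊕ x
      y∉D⊕x y∈ = ⊕-elim (_≢ y) D (λ z∈D z≡y → K∩D y∈K (subst (_∈ D) z≡y z∈D)) (y≢x ∘ sym) y∈ refl

    ∣B∣+∣D∣ : ∣ B ∣ + ∣ D ∣ ≡ ∣ p ∣
    ∣B∣+∣D∣ = ∣p─q∣+∣q∣≡∣p∣ p D D⊆p

    1≤D : 1 ≤ ∣ D ∣
    1≤D = ≤-trans (s≤s z≤n) (≤-reflexive (sym (∣p∣≡1+∣p-x∣ root)))

    5≤B : 5 ≤ ∣ B ∣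
    5≤B = ≤-trans (≤-reflexive (sym ∣K∣≡5)) (p⊆q⇒∣p∣≤∣q∣ K⊆B)

    3≤A : 3 ≤ ∣ A ∣
    3≤A = ≤-trans (s≤s (s≤s 1≤D)) (≤-reflexive (sym ∣A∣))

    A<p : ∣ A ∣ < ∣ p ∣
    A<p = ≤-trans (≤-reflexive (cong suc ∣A∣))
      (≤-trans (+-monoˡ-≤ ∣ D ∣ (≤-trans (s≤s (s≤s (s≤s z≤n))) 5≤B)) (≤-reflexive ∣B∣+∣D∣))

    B<p : ∣ B ∣ < ∣ p ∣
    B<p = ≤-trans (≤-reflexive (+-comm 1 ∣ B ∣)) (≤-trans (+-monoʳ-≤ ∣ B ∣ 1≤D) (≤-reflexive ∣B∣+∣D∣))

split-at-K5 : ∀ (G : Graph n) {p} → 6 ≤ ∣ p ∣ → ¬ K33-minor-in G p → CliqueIn G p 5 →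
  (∀ q → q ⊆ p → ∣ q ∣ < ∣ p ∣ → 3 ≤ ∣ q ∣ → Bound G q) → Bound G p
split-at-K5 G {p} 6≤p K33-free (K , K⊆p , clique , ∣K∣≡5) bound-sub with nonempty? (p ─ K)
... | no empty = contradiction (≤-trans 6≤p (≤-trans (p⊆q⇒∣p∣≤∣q∣ p⊆K) (≤-reflexive ∣K∣≡5))) 1+n≰n
  where
  p⊆K : p ⊆ K
  p⊆K {x} x∈p with x ∈? K
  ... | yes x∈K = x∈K
  ... | no x∉K = contradiction (x , x∈p∧x∉q⇒x∈p─q x∈p x∉K) empty
... | yes (w , w∈p─K) with 3 ≤? ∣ AroundK5.Q G K⊆p clique ∣K∣≡5 w∈p─K ∣
... | yes 3≤Q = contradiction (AroundK5.many-touching G K⊆p clique ∣K∣≡5 w∈p─K 3≤Q) K33-free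
... | no ¬3≤Q = AroundK5.split G K⊆p clique ∣K∣≡5 w∈p─K (s≤s⁻¹ (≰⇒> ¬3≤Q)) bound-sub

-- The degree of `w` inside `N(v)` is the number of common neighbours of `v` and `w`. So `codeg`
-- gives minimum degree 3 there without exceptions, and the search may start from any edge `ab` of
-- `N(v)`.
K5-or-K33 : ∀ (G : Graph n) {p v} → v ∈ p → (∀ {w} → w ∈ p → 4 ≤ ∣ p ∩ N G w ∣) →
  (∀ {u w} → u ∈ p → w ∈ p → Adj G u w → 3 ≤ ∣ (p ∩ N G u) ∩ N G w ∣) →
  CliqueIn G p 5 ⊎ K33-minor-in G p
K5-or-K33 G {p} {v} v∈p deg codeg
  with pick {p = p ∩ N G v} (deg v∈p)
... | a , a∈H , _ with ∈-p∩N⁻ G p a∈H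
... | a∈p , va with pick {p = (p ∩ N G v) ∩ N G a} (codeg v∈p a∈p va)
... | b , b∈ , _ with ∈-p∩N⁻ G (p ∩ N G v) b∈
... | b∈H , ab with ∈-p∩N⁻ G p b∈H
... | b∈p , vb with pick₂ {p = (p ∩ N G v) ∩ N G b} (codeg v∈p b∈p vb)
... | c₁ , c₂ , c₁∈ , c₂∈ , c₁≢c₂ , _ with other c₁ c₂ a c₁∈ c₂∈ c₁≢c₂
  where
  other : ∀ {q} c₁ c₂ a → c₁ ∈ q → c₂ ∈ q → c₁ ≢ c₂ → ∃ λ c → c ∈ q × c ≢ a
  other c₁ c₂ a c₁∈ c₂∈ c₁≢c₂ with c₁ ≟ a
  ... | no c₁≢a = c₁ , c₁∈ , c₁≢a
  ... | yes refl = c₂ , c₂∈ , c₁≢c₂ ∘ sym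
... | c , c∈ , c≢a with ∈-p∩N⁻ G (p ∩ N G v) c∈
... | c∈H , bc with K4-or-K33 _ G {v} {p ∩ N G v} ≤-refl (λ w∈ → proj₂ (∈-p∩N⁻ G p w∈)) a∈H b∈H ab c∈H bc c≢a
                     (λ w∈ _ _ → let w∈p , vw = ∈-p∩N⁻ G p w∈ in codeg v∈p w∈p vw)
... | inj₂ m = inj₂ (K33-⊆ (⊕-elim (_∈ p) (p ∩ N G v) (p∩q⊆p p (N G v)) v∈p) m)
... | inj₁ (K , K⊆H , clique , ∣K∣≡4) = inj₁ (CliqueIn-⊕ {G = G}
  (K , (λ x∈ → p∩q⊆p p (N G v) (K⊆H x∈)) , clique , ∣K∣≡4) v∈p (λ y∈ → proj₂ (∈-p∩N⁻ G p (K⊆H y∈))))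

-- `3 · 8 = 24` is within the 28 that one vertex contributes.
lose-one : ∀ c c′ w s′ → c ≤ c′ + w → w ≤ 8 → 3 * c′ + 44 ≤ 28 * s′ → 3 * c + 44 ≤ 28 * suc s′
lose-one c c′ w s′ c≤ w≤8 bound = begin
  3 * c + 44          ≤⟨ +-monoˡ-≤ 44 (*-monoʳ-≤ 3 (≤-trans c≤ (+-monoʳ-≤ c′ w≤8))) ⟩
  3 * (c′ + 8) + 44   ≡⟨ eq c′ ⟩
  24 + (3 * c′ + 44)  ≤⟨ +-mono-≤ (from-yes (24 ≤? 28)) bound ⟩
  28 + 28 * s′        ≡⟨ *-suc 28 s′ ⟨
  28 * suc s′         ∎
  where
  open ≤-Reasoning
  eq : ∀ c → 3 * (c + 8) + 44 ≡ 24 + (3 * c + 44)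
  eq = solve-∀

-- Equality holds at 5, the case of K₅. At 6 the estimate by `2 ^ m` already fails, as 236 exceeds
-- 168.
small-bound : ∀ m → 3 ≤ m → m ≤ 5 → 3 * 2 ^ m + 44 ≤ 28 * m
small-bound 3 _ _ = from-yes (68 ≤? 84)
small-bound 4 _ _ = from-yes (92 ≤? 112)
small-bound 5 _ _ = from-yes (140 ≤? 140)
small-bound (suc (suc (suc (suc (suc (suc m)))))) _ (s≤s (s≤s (s≤s (s≤s (s≤s ())))))
small-bound 1 (s≤s ())
small-bound 2 (s≤s (s≤s ()))

bound-small : ∀ (G : Graph n) p → 3 ≤ ∣ p ∣ → ∣ p ∣ ≤ 5 → Bound G p
bound-small G p 3≤p p≤5 =
  ≤-trans (+-monoˡ-≤ 44 (*-monoʳ-≤ 3 (cliques≤2^∣p∣ G p))) (small-bound ∣ p ∣ 3≤p p≤5)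

bound-delete : ∀ (G : Graph n) {p v} → v ∈ p → ∣ p ∩ N G v ∣ ≤ 3 → Bound G (p - v) → Bound G p
bound-delete G {p} {v} v∈p deg≤3 bound =
  subst (λ s → 3 * cliques G p + 44 ≤ 28 * s) (sym (∣p∣≡1+∣p-x∣ v∈p))
    (lose-one (cliques G p) (cliques G (p - v)) (cliques G (p ∩ N G v)) (∣ p - v ∣)
      (≤-reflexive (cliques-peel G v∈p))
      (≤-trans (cliques≤2^∣p∣ G (p ∩ N G v)) (^-monoʳ-≤ 2 deg≤3)) bound)

-- `2 · 2² = 8`, the same loss as the `2³` for deleting a vertex of degree 3.
bound-contract : ∀ (G : Graph n) {p u v} → u ∈ p → v ∈ p → Adj G u v → ∣ (p ∩ N G u) ∩ N G v ∣ ≤ 2 →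
  Bound (contract G u v) (p - v) → Bound G p
bound-contract G {p} {u} {v} u∈p v∈p uv W≤2 bound =
  subst (λ s → 3 * cliques G p + 44 ≤ 28 * s) (sym (∣p∣≡1+∣p-x∣ v∈p))
    (lose-one (cliques G p) (cliques (contract G u v) (p - v)) (2 * cliques G ((p ∩ N G u) ∩ N G v)) (∣ p - v ∣)
      (cliques-contract G u∈p v∈p uv)
      (*-monoʳ-≤ 2 (≤-trans (cliques≤2^∣p∣ G ((p ∩ N G u) ∩ N G v)) (^-monoʳ-≤ 2 W≤2))) bound)

-- The induction hypothesis covers all graphs because contraction changes the graph, and all smaller
-- sets because a split at a K₅ gives two parts of unforeseeable size.
bound-step : ∀ (G : Graph n) p → 3 ≤ ∣ p ∣ → ¬ K33-minor-in G p →
  (∀ G′ q → ∣ q ∣ < ∣ p ∣ → 3 ≤ ∣ q ∣ → ¬ K33-minor-in G′ q → Bound G′ q) → Bound G p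
bound-step {n} G p 3≤p K33-free IH = by-size (∣ p ∣ ≤? 5)
  where
  3≤p-v : ∀ {v} → 6 ≤ ∣ p ∣ → v ∈ p → 3 ≤ ∣ p - v ∣
  3≤p-v 6≤p v∈p = s≤s⁻¹ (≤-trans (from-yes (4 ≤? 6)) (≤-trans 6≤p (≤-reflexive (∣p∣≡1+∣p-x∣ v∈p))))

  LowDegree : Fin n → Set
  LowDegree v = v ∈ p × ∣ p ∩ N G v ∣ ≤ 3

  LowCodegree : Fin n → Fin n → Set
  LowCodegree u v = u ∈ p × v ∈ p × Adj G u v × ∣ (p ∩ N G u) ∩ N G v ∣ ≤ 2

  from-K5 : 6 ≤ ∣ p ∣ → CliqueIn G p 5 ⊎ K33-minor-in G p → Bound G p
  from-K5 6≤p (inj₁ K5) = split-at-K5 G 6≤p K33-free K5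
    λ q q⊆p q<p 3≤q → IH G q q<p 3≤q (λ m → K33-free (K33-⊆ q⊆p m))
  from-K5 6≤p (inj₂ m) = contradiction m K33-free

  dense : ¬ ∃ LowDegree → ¬ (∃ λ u → ∃ (LowCodegree u)) → CliqueIn G p 5 ⊎ K33-minor-in G p
  dense min-deg min-codeg with pick {p = p} {0} (≤-trans (s≤s z≤n) 3≤p)
  ... | v , v∈p , _ = K5-or-K33 G v∈p
    (λ {w} w∈p → ≰⇒> λ deg≤3 → min-deg (w , w∈p , deg≤3))
    (λ {u} {w} u∈p w∈p uw → ≰⇒> λ W≤2 → min-codeg (u , w , u∈p , w∈p , uw , W≤2))

  by-codegree : 6 ≤ ∣ p ∣ → ¬ ∃ LowDegree → Dec (∃ λ u → ∃ (LowCodegree u)) → Bound G p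
  by-codegree 6≤p min-deg (yes (u , v , u∈p , v∈p , uv , W≤2)) = bound-contract G u∈p v∈p uv W≤2
    (IH (contract G u v) (p - v) (x∈p⇒∣p-x∣<∣p∣ v∈p) (3≤p-v 6≤p v∈p) (K33-free ∘ K33-contract G u∈p v∈p uv))
  by-codegree 6≤p min-deg (no min-codeg) = from-K5 6≤p (dense min-deg min-codeg)

  by-degree : 6 ≤ ∣ p ∣ → Dec (∃ LowDegree) → Bound G p
  by-degree 6≤p (yes (v , v∈p , deg≤3)) = bound-delete G v∈p deg≤3
    (IH G (p - v) (x∈p⇒∣p-x∣<∣p∣ v∈p) (3≤p-v 6≤p v∈p) (K33-free ∘ K33-⊆ (p─q⊆p p ⁅ v ⁆)))
  by-degree 6≤p (no min-deg) = by-codegree 6≤p min-deg (any? λ u → any? λ v →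
    (u ∈? p) ×-dec (v ∈? p) ×-dec (adj G u v Bool.≟ true) ×-dec (∣ (p ∩ N G u) ∩ N G v ∣ ≤? 2))

  by-size : Dec (∣ p ∣ ≤ 5) → Bound G p
  by-size (yes p≤5) = bound-small G p 3≤p p≤5
  by-size (no p≰5) = by-degree (≰⇒> p≰5) (any? λ v → (v ∈? p) ×-dec (∣ p ∩ N G v ∣ ≤? 3))

clique-bound : ∀ k (G : Graph n) p → ∣ p ∣ ≤ k → 3 ≤ ∣ p ∣ → ¬ K33-minor-in G p → Bound G p
clique-bound zero G p p≤0 3≤p _ with () ← ≤-trans 3≤p p≤0
clique-bound (suc k) G p p≤ 3≤p K33-free = bound-step G p 3≤p K33-free
  λ G′ q q<p → clique-bound k G′ q (s≤s⁻¹ (≤-trans q<p p≤))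

cliques-Clique : ∀ (G : Graph n) {p} → Clique G p → cliques G p ≡ 2 ^ ∣ p ∣
cliques-Clique G {[]} cl = refl
cliques-Clique G {outside ∷ p} cl =
  cliques-Clique (tail G) λ x∈ y∈ x≢y → cl (there x∈) (there y∈) λ { refl → x≢y refl }
cliques-Clique G {inside ∷ p} cl = begin
  cliques (tail G) p + cliques (tail G) (p ∩ N₀ G)
    ≡⟨ cong (λ q → cliques (tail G) p + cliques (tail G) q) (⊆-antisym (p∩q⊆p p (N₀ G))
         λ x∈ → x∈p∩q⁺ (x∈ , ∈-tabulate⁺ (cl here (there x∈) λ ()))) ⟩
  cliques (tail G) p + cliques (tail G) p
    ≡⟨ cong (λ m → m + m) (cliques-Clique (tail G) λ x∈ y∈ x≢y → cl (there x∈) (there y∈) λ { refl → x≢y refl }) ⟩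
  2 ^ ∣ p ∣ + 2 ^ ∣ p ∣
    ≡⟨ cong (2 ^ ∣ p ∣ +_) (+-identityʳ _) ⟨
  2 ^ suc ∣ p ∣ ∎
  where open ≡-Reasoning

-- The extremal graphs: k triangles, all joined to the two ends of an edge

-- Labels: 0 for the two vertices of the common edge, i ≥ 1 for the vertices of the i-th triangle.
label : ∀ k → Fin (k * 3 + 2) → ℕ
label zero _ = 0
label (suc k) zero = suc k
label (suc k) (suc zero) = suc k
label (suc k) (suc (suc zero)) = suc k
label (suc k) (suc (suc (suc i))) = label k i

compatible : ℕ → ℕ → Bool
compatible zero _ = true
compatible (suc _) zero = true
compatible (suc a) (suc b) = a ≡ᵇ b

≡ᵇ-refl : ∀ a → (a ≡ᵇ a) ≡ true
≡ᵇ-refl a = Equivalence.to T-≡ (≡⇒≡ᵇ a a refl)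

≡ᵇ-sym : ∀ a b → (a ≡ᵇ b) ≡ (b ≡ᵇ a)
≡ᵇ-sym zero zero = refl
≡ᵇ-sym zero (suc b) = refl
≡ᵇ-sym (suc a) zero = refl
≡ᵇ-sym (suc a) (suc b) = ≡ᵇ-sym a b

compatible-sym : ∀ a b → compatible a b ≡ compatible b a
compatible-sym zero zero = refl
compatible-sym zero (suc b) = refl
compatible-sym (suc a) zero = refl
compatible-sym (suc a) (suc b) = ≡ᵇ-sym a b

-- Fails with `0` in place of `suc l`, since `0` is compatible with everything. Labels compatible
-- with `suc l` are only `0` and `suc l`.
compatible-trans : ∀ a b l → compatible (suc l) a ≡ true → compatible (suc l) b ≡ true → compatible a b ≡ true
compatible-trans zero b l la lb = refl
compatible-trans (suc a) zero l la lb = refl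
compatible-trans (suc a) (suc b) l la lb
  with refl ← ≡ᵇ⇒≡ l a (Equivalence.from T-≡ la) | refl ← ≡ᵇ⇒≡ l b (Equivalence.from T-≡ lb) = la

-- A property instead of one particular graph, so that it passes to `tail` while vertices are peeled
-- off.
Labelled : Graph n → (Fin n → ℕ) → Set
Labelled G ℓ = ∀ x y → x ≢ y → adj G x y ≡ compatible (ℓ x) (ℓ y)

Labelled-tail : ∀ {G : Graph (suc n)} {ℓ} → Labelled G ℓ → Labelled (tail G) (ℓ ∘ suc)
Labelled-tail lab x y x≢y = lab (suc x) (suc y) λ { refl → x≢y refl }

labelled : ∀ (ℓ : Fin n → ℕ) → ∃ λ (G : Graph n) → Labelled G ℓ
labelled ℓ = G , lab
  where
  G = record
    { adj = λ x y → not (is x y) ∧ compatible (ℓ x) (ℓ y)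
    ; sym = λ x y → cong₂ (λ a b → not a ∧ b) (is-sym x y) (compatible-sym (ℓ x) (ℓ y))
    ; irrefl = λ x → cong (λ b → not b ∧ compatible (ℓ x) (ℓ x)) (is-refl x) }
  lab : Labelled G ℓ
  lab x y x≢y = cong (λ b → not b ∧ compatible (ℓ x) (ℓ y)) (is-≢ λ y≡x → x≢y (sym y≡x))

near : ℕ → (Fin n → ℕ) → Subset n
near l ℓ = tabulate (λ i → compatible l (ℓ i))

near-Clique : ∀ {G : Graph n} {ℓ} → Labelled G ℓ → ∀ l → Clique G (near (suc l) ℓ)
near-Clique {ℓ = ℓ} lab l {x} {y} x∈ y∈ x≢y =
  trans (lab x y x≢y) (compatible-trans (ℓ x) (ℓ y) l (∈-tabulate⁻ x∈) (∈-tabulate⁻ y∈))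

-- The later neighbours of a triangle vertex form a clique, so each of their subsets extends to a
-- clique with that vertex.
cliques-∷⊤ : ∀ (G : Graph (suc n)) ℓ → Labelled G ℓ → ∀ l → ℓ zero ≡ suc l →
  cliques G ⊤ ≡ cliques (tail G) ⊤ + 2 ^ ∣ near (suc l) (ℓ ∘ suc) ∣
cliques-∷⊤ G ℓ lab l ℓ₀ = cong (cliques (tail G) ⊤ +_) (trans
  (cong (cliques (tail G)) (trans (∩-identityˡ (N₀ G))
    (tabulate-cong λ i → trans (lab zero (suc i) λ ()) (cong (λ m → compatible m (ℓ (suc i))) ℓ₀))))
  (cliques-Clique (tail G) (near-Clique {G = tail G} {ℓ ∘ suc} (Labelled-tail {G = G} {ℓ} lab) l)))

<⇒≡ᵇ-false : ∀ {a b} → a < b → (b ≡ᵇ a) ≡ false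
<⇒≡ᵇ-false {zero} {suc b} _ = refl
<⇒≡ᵇ-false {suc a} {suc b} (s≤s a<b) = <⇒≡ᵇ-false a<b

-- For `k ≤ l` the label `suc l` does not occur, so only the two vertices labelled 0 count.
∣near∣ : ∀ l k → k ≤ l → ∣ near (suc l) (label k) ∣ ≡ 2
∣near∣ l zero _ = refl
∣near∣ l (suc k) k<l rewrite <⇒≡ᵇ-false k<l = ∣near∣ l k (<⇒≤ k<l)

-- Peeled in order, the vertices of the top triangle have 4, 3 and 2 later neighbours, which adds
-- `16 + 8 + 4 = 28` to the 4 cliques of the edge.
count-triangles : ∀ k (G : Graph (k * 3 + 2)) → Labelled G (label k) → cliques G ⊤ ≡ 4 + 28 * k
count-triangles zero G lab = cliques-Clique G {⊤} λ {x} {y} _ _ x≢y → lab x y x≢y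
count-triangles (suc k) G lab = begin
  cliques G ⊤
    ≡⟨ cliques-∷⊤ G (label (suc k)) lab k refl ⟩
  cliques G₁ ⊤ + 2 ^ ∣ near (suc k) ℓ₁ ∣
    ≡⟨ cong₂ (λ c m → c + 2 ^ m) (cliques-∷⊤ G₁ ℓ₁ lab₁ k refl) size₁ ⟩
  (cliques G₂ ⊤ + 2 ^ ∣ near (suc k) ℓ₂ ∣) + 16
    ≡⟨ cong₂ (λ c m → (c + 2 ^ m) + 16) (cliques-∷⊤ G₂ ℓ₂ lab₂ k refl) size₂ ⟩
  ((cliques (tail G₂) ⊤ + 2 ^ ∣ near (suc k) (label k) ∣) + 8) + 16
    ≡⟨ cong₂ (λ c m → ((c + 2 ^ m) + 8) + 16) (count-triangles k (tail G₂) lab₃) size₃ ⟩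
  ((4 + 28 * k + 4) + 8) + 16
    ≡⟨ eq k ⟩
  4 + 28 * suc k ∎
  where
  open ≡-Reasoning
  G₁ = tail G
  G₂ = tail G₁
  ℓ₁ : Fin (2 + (k * 3 + 2)) → ℕ
  ℓ₁ i = label (suc k) (suc i)
  ℓ₂ : Fin (1 + (k * 3 + 2)) → ℕ
  ℓ₂ i = label (suc k) (suc (suc i))
  lab₁ : Labelled G₁ ℓ₁
  lab₁ = Labelled-tail {G = G} {label (suc k)} lab
  lab₂ : Labelled G₂ ℓ₂
  lab₂ = Labelled-tail {G = G₁} {ℓ₁} lab₁
  lab₃ : Labelled (tail G₂) (label k)
  lab₃ = Labelled-tail {G = G₂} {ℓ₂} lab₂
  eq : ∀ k → ((4 + 28 * k + 4) + 8) + 16 ≡ 4 + 28 * suc k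
  eq = solve-∀
  size₃ : ∣ near (suc k) (label k) ∣ ≡ 2
  size₃ = ∣near∣ k k ≤-refl
  size₂ : ∣ near (suc k) ℓ₂ ∣ ≡ 3
  size₂ rewrite ≡ᵇ-refl k = cong suc size₃
  size₁ : ∣ near (suc k) ℓ₁ ∣ ≡ 4
  size₁ rewrite ≡ᵇ-refl k = cong (λ m → 2 + m) size₃

-- Absence of K₃,₃ minors in the extremal graphs

hub : ∀ k → Fin 2 → Fin (k * 3 + 2)
hub zero i = i
hub (suc k) i = suc (suc (suc (hub k i)))

label≡0 : ∀ k {x} → label k x ≡ 0 → ∃ λ i → x ≡ hub k i
label≡0 zero {x} _ = x , refl
label≡0 (suc k) {suc (suc (suc x))} eq with label≡0 k eq
... | i , refl = i , refl

-- Position within the triangle. The value at the two hubs is a mere default, and injectivity is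
-- claimed only for non-zero labels.
corner : ∀ k → Fin (k * 3 + 2) → Fin 3
corner zero _ = zero
corner (suc k) zero = zero
corner (suc k) (suc zero) = suc zero
corner (suc k) (suc (suc zero)) = suc (suc zero)
corner (suc k) (suc (suc (suc i))) = corner k i

label≤k : ∀ k x → label k x ≤ k
label≤k zero x = z≤n
label≤k (suc k) zero = ≤-refl
label≤k (suc k) (suc zero) = ≤-refl
label≤k (suc k) (suc (suc zero)) = ≤-refl
label≤k (suc k) (suc (suc (suc x))) = m≤n⇒m≤1+n (label≤k k x)

label-corner-injective : ∀ k {x y} → label k x ≢ 0 → label k x ≡ label k y → corner k x ≡ corner k y → x ≡ y
label-corner-injective zero ≢0 _ _ = contradiction refl ≢0
label-corner-injective (suc k) {suc (suc (suc x))} {suc (suc (suc y))} ≢0 l≡ c≡ =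
  cong (λ z → suc (suc (suc z))) (label-corner-injective k ≢0 l≡ c≡)
label-corner-injective (suc k) {zero} {zero} _ _ _ = refl
label-corner-injective (suc k) {suc zero} {suc zero} _ _ _ = refl
label-corner-injective (suc k) {suc (suc zero)} {suc (suc zero)} _ _ _ = refl
label-corner-injective (suc k) {zero} {suc zero} _ _ ()
label-corner-injective (suc k) {zero} {suc (suc zero)} _ _ ()
label-corner-injective (suc k) {suc zero} {zero} _ _ ()
label-corner-injective (suc k) {suc zero} {suc (suc zero)} _ _ ()
label-corner-injective (suc k) {suc (suc zero)} {zero} _ _ ()
label-corner-injective (suc k) {suc (suc zero)} {suc zero} _ _ ()
label-corner-injective (suc k) {zero} {suc (suc (suc y))} _ l≡ _ = contradiction (≤-trans (≤-reflexive l≡) (label≤k k y)) 1+n≰n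
label-corner-injective (suc k) {suc zero} {suc (suc (suc y))} _ l≡ _ = contradiction (≤-trans (≤-reflexive l≡) (label≤k k y)) 1+n≰n
label-corner-injective (suc k) {suc (suc zero)} {suc (suc (suc y))} _ l≡ _ = contradiction (≤-trans (≤-reflexive l≡) (label≤k k y)) 1+n≰n
label-corner-injective (suc k) {suc (suc (suc x))} {zero} _ l≡ _ = contradiction (≤-trans (≤-reflexive (sym l≡)) (label≤k k x)) 1+n≰n
label-corner-injective (suc k) {suc (suc (suc x))} {suc zero} _ l≡ _ = contradiction (≤-trans (≤-reflexive (sym l≡)) (label≤k k x)) 1+n≰n
label-corner-injective (suc k) {suc (suc (suc x))} {suc (suc zero)} _ l≡ _ = contradiction (≤-trans (≤-reflexive (sym l≡)) (label≤k k x)) 1+n≰n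

abstract
  K33-dominating-edge : ∀ i j → Adj K33 i j → ∀ l → Adj K33 i l ⊎ Adj K33 j l
  K33-dominating-edge = from-yes (all? λ i → all? λ j → (adj K33 i j Bool.≟ true) →-dec
    (all? λ l → (adj K33 i l Bool.≟ true) ⊎-dec (adj K33 j l Bool.≟ true)))

  -- Two vertices cannot exhaust a side of three, so a vertex survives on each side.
  K33-minus-two : ∀ (e₁ e₂ : Fin 6) → ∃ λ i → ∃ λ j → (i ≢ e₁ × i ≢ e₂) × (j ≢ e₁ × j ≢ e₂) × Adj K33 i j
  K33-minus-two = from-yes (all? λ e₁ → all? λ e₂ → any? λ i → any? λ j →
    (¬? (i ≟ e₁) ×-dec ¬? (i ≟ e₂)) ×-dec (¬? (j ≟ e₁) ×-dec ¬? (j ≟ e₂)) ×-dec (adj K33 i j Bool.≟ true))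

module MinorOfTriangles (k : ℕ) (G : Graph (k * 3 + 2)) (lab : Labelled G (label k)) (M : IsMinor K33 G) where

  open MinorModel M
  V = Fin (k * 3 + 2)
  -- The branch set of each hub. For a hub in no branch set the default `zero` is harmless: it
  -- merely excludes an index from `Free`.
  e : Fin 2 → Fin 6
  e i = fromMaybe zero (branch (hub k i))
  e₁ = e zero
  e₂ = e (suc zero)

  Free : Fin 6 → Set
  Free i = i ≢ e₁ × i ≢ e₂

  free⇒label≢0 : ∀ {i x} → Free i → branch x ≡ just i → label k x ≢ 0
  free⇒label≢0 {i} (i≢e₁ , i≢e₂) Bx ℓ≡0 with label≡0 k ℓ≡0
  ... | zero , refl = i≢e₁ (sym (cong (fromMaybe zero) Bx))
  ... | suc zero , refl = i≢e₂ (sym (cong (fromMaybe zero) Bx))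

  same-label : ∀ {x y} → Adj G x y → label k x ≢ 0 → label k y ≢ 0 → label k x ≡ label k y
  same-label {x} {y} xy x≢0 y≢0 = compatible⇒≡ (trans (sym (lab x y (Adj⇒≢ G xy))) xy) x≢0 y≢0
    where
    compatible⇒≡ : ∀ {a b} → compatible a b ≡ true → a ≢ 0 → b ≢ 0 → a ≡ b
    compatible⇒≡ {zero} _ a≢0 _ = contradiction refl a≢0
    compatible⇒≡ {suc a} {zero} _ _ b≢0 = contradiction refl b≢0
    compatible⇒≡ {suc a} {suc b} eq _ _ = cong suc (≡ᵇ⇒≡ a b (Equivalence.from T-≡ eq))

  walk-label : ∀ {i x y} → Free i → branch x ≡ just i → Connected G (λ w → branch w ≡ just i) x y →
               label k x ≡ label k y
  walk-label free Bx here = refl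
  walk-label free Bx (step xz Bz w) =
    trans (same-label xz (free⇒label≢0 free Bx) (free⇒label≢0 free Bz)) (walk-label free Bz w)

  rep : Fin 6 → V
  rep i = proj₁ (nonempty i)

  adjacent-label : ∀ {i j} → Free i → Free j → Adj K33 i j → label k (rep i) ≡ label k (rep j)
  adjacent-label {i} {j} fi fj ij with edges i j ij
  ... | x , y , Bx , By , xy = begin
    label k (rep i) ≡⟨ walk-label fi (proj₂ (nonempty i)) (connected i _ x (proj₂ (nonempty i)) Bx) ⟩
    label k x       ≡⟨ same-label xy (free⇒label≢0 fi Bx) (free⇒label≢0 fj By) ⟩
    label k y       ≡⟨ walk-label fj By (connected j y _ By (proj₂ (nonempty j))) ⟩
    label k (rep j) ∎
    where open ≡-Reasoning

  -- Some edge `ij` of `K33` avoids `e₁` and `e₂`, and every vertex is adjacent to one of its ends,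
  -- so all free branch sets share the label of `i`.
  free-label : ∀ {l m} → Free l → Free m → label k (rep l) ≡ label k (rep m)
  free-label {l} {m} fl fm with K33-minus-two e₁ e₂
  ... | i , j , fi , fj , ij = trans (sym (to-i l fl)) (to-i m fm)
    where
    to-i : ∀ l → Free l → label k (rep i) ≡ label k (rep l)
    to-i l fl with K33-dominating-edge i j ij l
    ... | inj₁ il = adjacent-label fi fl il
    ... | inj₂ jl = trans (adjacent-label fi fj ij) (adjacent-label fj fl jl)

  free-injective : ∀ {i j} → Free i → Free j → corner k (rep i) ≡ corner k (rep j) → i ≡ j
  free-injective {i} {j} fi fj c≡ = just-injective (begin
    just i          ≡⟨ proj₂ (nonempty i) ⟨
    branch (rep i)  ≡⟨ cong branch (label-corner-injective k (free⇒label≢0 fi (proj₂ (nonempty i))) (free-label fi fj) c≡) ⟩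
    branch (rep j)  ≡⟨ proj₂ (nonempty j) ⟩
    just j          ∎)
    where open ≡-Reasoning

  -- Three codes for the corners of the common triangle and one for each of `e₁` and `e₂`: five
  -- codes for six branch sets, which the pigeonhole principle forbids.
  code : Fin 6 → Fin 5
  code i with i ≟ e₁ | i ≟ e₂
  ... | yes _ | _ = 3 ↑ʳ zero
  ... | no _ | yes _ = 3 ↑ʳ suc zero
  ... | no _ | no _ = corner k (rep i) ↑ˡ 2

  corner≢ : ∀ (c : Fin 3) (d : Fin 2) → c ↑ˡ 2 ≢ 3 ↑ʳ d
  corner≢ zero d ()
  corner≢ (suc zero) d ()
  corner≢ (suc (suc zero)) d ()

  code-injective : ∀ {i j} → code i ≡ code j → i ≡ j
  code-injective {i} {j} eq with i ≟ e₁ | i ≟ e₂ | j ≟ e₁ | j ≟ e₂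
  ... | yes i≡ | _ | yes j≡ | _ = trans i≡ (sym j≡)
  ... | no _ | yes i≡ | no _ | yes j≡ = trans i≡ (sym j≡)
  ... | no i≢₁ | no i≢₂ | no j≢₁ | no j≢₂ = free-injective (i≢₁ , i≢₂) (j≢₁ , j≢₂) (↑ˡ-injective 2 _ _ eq)
  ... | yes _ | _ | no _ | yes _ = contradiction eq λ ()
  ... | no _ | yes _ | yes _ | _ = contradiction eq λ ()
  ... | yes _ | _ | no _ | no _ = contradiction (sym eq) (corner≢ _ zero)
  ... | no _ | yes _ | no _ | no _ = contradiction (sym eq) (corner≢ _ (suc zero))
  ... | no _ | no _ | yes _ | _ = contradiction eq (corner≢ _ zero)
  ... | no _ | no _ | no _ | yes _ = contradiction eq (corner≢ _ (suc zero))

triangles-K33-free : ∀ k (G : Graph (k * 3 + 2)) → Labelled G (label k) → ¬ IsMinor K33 G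
triangles-K33-free k G lab M with pigeonhole (from-yes (5 <? 6)) (MinorOfTriangles.code k G lab M)
... | i , j , i<j , eq = <⇒≢ i<j (MinorOfTriangles.code-injective k G lab M eq)

theorem7 : ((n : ℕ) → 3 ≤ n → (G : Graph n) → ¬ IsMinor K33 G →
    3 * numCliques G ≤ 4 * (7 * n ∸ 11))
    × ((n : ℕ) → 5 ≤ n → n % 3 ≡ 2 →
    Σ (Graph n) (λ G → ¬ IsMinor K33 G × 3 * numCliques G ≡ 4 * (7 * n ∸ 11)))
theorem7 = upper , lower
  where
  upper : (n : ℕ) → 3 ≤ n → (G : Graph n) → ¬ IsMinor K33 G → 3 * numCliques G ≤ 4 * (7 * n ∸ 11)
  upper n 3≤n G K33-free = begin
    3 * numCliques G    ≡⟨ cong (3 *_) (numCliques≡cliques G) ⟩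
    3 * cliques G ⊤     ≤⟨ m+n≤o⇒m≤o∸n (3 * cliques G ⊤) bound ⟩
    28 * n ∸ 44         ≡⟨ cong (_∸ 44) (*-assoc 4 7 n) ⟩
    4 * (7 * n) ∸ 44    ≡⟨ *-distribˡ-∸ 4 (7 * n) 11 ⟨
    4 * (7 * n ∸ 11)    ∎
    where
    open ≤-Reasoning
    bound : 3 * cliques G ⊤ + 44 ≤ 28 * n
    bound = subst (λ s → 3 * cliques G ⊤ + 44 ≤ 28 * s) (∣⊤∣≡n n)
      (clique-bound n G ⊤ (≤-reflexive (∣⊤∣≡n n)) (≤-trans 3≤n (≤-reflexive (sym (∣⊤∣≡n n))))
        (K33-free ∘ K33-minor-in.model))

  lower : (n : ℕ) → 5 ≤ n → n % 3 ≡ 2 →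
          Σ (Graph n) (λ G → ¬ IsMinor K33 G × 3 * numCliques G ≡ 4 * (7 * n ∸ 11))
  lower n _ n%3≡2 = subst (λ n → Σ (Graph n) (λ G → ¬ IsMinor K33 G × 3 * numCliques G ≡ 4 * (7 * n ∸ 11)))
    (sym n≡) (G , triangles-K33-free k G lab , (begin
      3 * numCliques G          ≡⟨ cong (3 *_) (trans (numCliques≡cliques G) (count-triangles k G lab)) ⟩
      3 * (4 + 28 * k)          ≡⟨ eq₁ k ⟩
      4 * (21 * k + 3)          ≡⟨ cong (4 *_) (m+n∸n≡m (21 * k + 3) 11) ⟨
      4 * (21 * k + 3 + 11 ∸ 11) ≡⟨ cong (λ m → 4 * (m ∸ 11)) (eq₂ k) ⟩
      4 * (7 * (k * 3 + 2) ∸ 11) ∎))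
    where
    open ≡-Reasoning
    k = n / 3
    G = proj₁ (labelled (label k))
    lab = proj₂ (labelled (label k))
    n≡ : n ≡ k * 3 + 2
    n≡ = trans (m≡m%n+[m/n]*n n 3) (trans (cong (_+ k * 3) n%3≡2) (+-comm 2 (k * 3)))
    eq₁ : ∀ k → 3 * (4 + 28 * k) ≡ 4 * (21 * k + 3)
    eq₁ = solve-∀
    eq₂ : ∀ k → 21 * k + 3 + 11 ≡ 7 * (k * 3 + 2)
    eq₂ = solve-∀
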